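{- For every $r\ge 3$ and $t\ge 2$, \[ \pi(\mathcal D_{r,t+1})\le 1-\frac1t-\frac{1}{12t^2}. \]
   Context: An $r$-graph is a collection of $r$-element subsets (edges) of a finite vertex set. For a family/graph $\mathcal F$ of $r$-graphs, an $r$-graph is $\mathcal F$-free if it contains no member of $\mathcal F$ as a (not necessarily induced) subgraph; $\operatorname{ex}(n,\mathcal F)$ is the maximum number of edges of an $\mathcal F$-free $r$-graph on $n$ vertices, and the Turán density is $\pi(\mathcal F)=\lim_{n\to\infty}\operatorname{ex}(n,\mathcal F)/\binom nr$ (this limit exists). For a graph $F$, its $r$-suspension is the $r$-graph obtained by adding a fixed set $S$ of $r-2$ new vertices to every edge of $F$, i.e. with edges $e\cup S$ for $e\in E(F)$. The $(r,t)$-daisy $\mathcal D_{r,t}$ is the $r$-suspension of the complete graph $K_t$. -}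

module Defs where

open import Data.Nat using (ℕ; zero; suc; _+_; _*_; _∸_)
open import Data.Nat.Combinatorics using (_C_)
open import Data.Bool using (Bool; true; false)
open import Data.Fin using (Fin; zero; suc; _↑ˡ_; _↑ʳ_)
open import Data.Fin.Subset using (Subset; ⁅_⁆; _∪_; ⋃; ∣_∣)
open import Data.Vec using (Vec; []; _∷_; replicate; _++_)
open import Data.List using (List; []; _∷_; map; length; concatMap; filter)
open import Data.Fin using (_<?_)
import Data.Fin as Fin
import Data.Nat as ℕ
open import Data.List using () renaming (allFin to allFin)
open import Data.Empty using (⊥)
open import Data.List.Membership.Propositional using (_∈_)
open import Data.List.Relation.Unary.All using (All)
open import Data.List.Relation.Unary.Unique.Propositional using (Unique)
open import Data.Integer using (+_)
open import Data.Rational using (ℚ; _/_; 0ℚ; 1ℚ)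
import Data.Rational as ℚ
open import Data.Product using (Σ; ∃; _×_; _,_)
open import Function.Definitions using (Injective)
open import Relation.Binary.PropositionalEquality using (_≡_)

record RGraph (r n : ℕ) : Set where
  field
    edges    : List (Subset n)
    unique   : Unique edges
    uniform  : All (λ e → ∣ e ∣ ≡ r) edges
open RGraph public

e[_] : ∀ {r n} → RGraph r n → ℕ
e[ H ] = length (edges H)

elems : ∀ {m} → Subset m → List (Fin m)
elems []            = []
elems (true ∷ s)    = zero ∷ map suc (elems s)
elems (false ∷ s)   = map suc (elems s)

image : ∀ {m n} → (Fin m → Fin n) → Subset m → Subset n
image f e = ⋃ (map (λ u → ⁅ f u ⁆) (elems e))

Contains : ∀ {r m n} → RGraph r n → List (Subset m) → Set
Contains {m = m} {n = n} H F =
  Σ (Fin m → Fin n) λ f → Injective _≡_ _≡_ f × All (λ e → image f e ∈ edges H) F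

Kedges : (t : ℕ) → List (Subset t)
Kedges t = concatMap (λ j → map (λ i → ⁅ i ⁆ ∪ ⁅ j ⁆) (filter (λ i → i Fin.<? j) (allFin t))) (allFin t)

suspendEdge : ∀ {m} (k : ℕ) → Subset m → Subset (k + m)
suspendEdge k e = replicate k true ++ e

suspension : ∀ {m} (r : ℕ) → List (Subset m) → List (Subset ((r ∸ 2) + m))
suspension r E = map (suspendEdge (r ∸ 2)) E

daisy : (r t : ℕ) → List (Subset ((r ∸ 2) + t))
daisy r t = suspension r (Kedges t)

-- 1/k as a rational (only used for k ≥ 1)
recipℕ : ℕ → ℚ
recipℕ zero    = 0ℚ
recipℕ (suc k) = + 1 / suc k

bound : ℕ → ℚ
bound t = 1ℚ ℚ.- recipℕ t ℚ.- recipℕ (12 * (t * t))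

toℚ : ℕ → ℚ
toℚ k = + k / 1

-- π(D_{r,t+1}) ≤ c, written out: since the limit defining π exists, π ≤ c iff
-- for every ε > 0 there is N such that for n ≥ N every D_{r,t+1}-free r-graph on
-- n vertices has at most (c + ε) (n choose r) edges.
TuranDensityDaisy≤ : (r t : ℕ) → ℚ → Set
TuranDensityDaisy≤ r t c =
  (ε : ℚ) → 0ℚ ℚ.< ε →
  Σ ℕ λ N → (n : ℕ) → N ℕ.≤ n → (H : RGraph r n) →
    (Contains H (daisy r (suc t)) → ⊥) →
    toℚ e[ H ] ℚ.≤ (c ℚ.+ ε) ℚ.* toℚ (n C r)

{-# OPTIONS --safe #-}
module Submission where

-- Let N be the set of ordered triples of vertices (repetitions allowed) that,
-- together with a fixed (r-3)-tuple, do not form an edge.  Daisy-freeness says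
-- that no link N_v contains t+1 pairwise non-adjacent vertices, so Motzkin–Straus
-- gives |N| ≥ n³/t; write |N| = (1/t + η)n³.  The recursive proof of Motzkin–Straus
-- also bounds by η the density of cherries (v;x,y,z): vxz, vyz ∈ N but vxy ∉ N.
-- If there were no cherries, N would be a linear space with t lines through each
-- point and lines of n/t points.  But given a, b and v off the line ab, the points
-- of that line contain a 1/t proportion of pairs u, w with vuw ∈ N, and each such
-- configuration contains a cherry; this forces cherry density of order 1/t².
-- Codegrees are kept under control by truncating the neighbourhoods N(a,b) to
-- about 4n/(3t) elements, and the truncated excess is again bounded by η.  For t = 2
-- counting the triples inside 4-tuples is enough.

open import Defs
open import Data.Bool using (Bool; true; false; not)
import Data.Bool.Properties as Boolₚ
open import Data.Empty using (⊥; ⊥-elim)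
open import Data.Fin as Fin using (Fin; zero; suc; _↑ˡ_; _↑ʳ_; splitAt)
import Data.Fin.Properties as Finₚ
open import Data.Fin.Subset as Subset using (Subset; ⁅_⁆; _∪_; ⋃; ∣_∣)
open import Data.Fin.Subset.Properties using (x∈p∪q⁻; x∈p∪q⁺; x∈⁅x⁆; x∈⁅y⁆⇒x≡y; ∉⊥; ⊆-antisym; ∪-identityˡ; ∣⊥∣≡0)
open import Data.Integer as ℤ using (ℤ; +_; +[1+_]; -[1+_]; 0ℤ; 1ℤ; -1ℤ; _≤_; _<_; +≤+; +<+)
import Data.Integer.Properties as ℤₚ
open import Data.Integer.Properties using (≤-refl; ≤-reflexive; ≤-trans; ≤-antisym; <-irrefl; ≤∧≢⇒<; ≮⇒≥; _≟_; _<?_; _≤?_)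
open import Data.Integer.Tactic.RingSolver using (solve-∀)
open import Data.List as List using (List; []; _∷_; length)
open import Data.List.Membership.Propositional using (_∈_)
open import Data.List.Membership.Propositional.Properties using (∈-map⁺; ∈-map⁻; ∈-concatMap⁻; ∈-filter⁻)
open import Data.List.Relation.Unary.All as All using (All; []; _∷_)
open import Data.List.Relation.Unary.AllPairs as AllPairs using (AllPairs; []; _∷_)
open import Data.List.Relation.Unary.Any as Any using (here; there)
open import Data.List.Relation.Unary.Unique.Propositional using (Unique)
open import Data.Nat as ℕ using (ℕ; zero; suc; _!; _∸_; _^_; s≤s; z≤n)
open import Data.Nat.Combinatorics using (_C_)
open import Data.Nat.Combinatorics.Base using (_P′_)
open import Data.Nat.Combinatorics.Specification using (nCk≡n!/k![n-k]!; nC′k≡n!/k![n-k]!; k!∣nP′k)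
open import Data.Nat.Coprimality using (Coprime)
import Data.Nat.DivMod as ℕ
import Data.Nat.Properties as ℕₚ
open import Data.Nat.Tactic.RingSolver using () renaming (solve-∀ to solve-∀ℕ)
open import Data.Product using (_×_; _,_; proj₂; ∃)
open import Data.Rational as ℚ using (ℚ; mkℚ; 1ℚ; toℚᵘ)
import Data.Rational.Properties as ℚₚ
open import Data.Rational.Unnormalised as ℚᵘ using (ℚᵘ; mkℚᵘ; _≃_)
import Data.Rational.Unnormalised.Properties as ℚᵘₚ
open import Data.Sum as Sum using (_⊎_; inj₁; inj₂)
open import Data.Vec as Vec using (Vec; []; _∷_; lookup)
open import Data.Vec.Membership.Propositional using () renaming (_∈_ to _∈ᵥ_)
open import Data.Vec.Membership.Propositional.Properties using (∈-lookup)
import Data.Vec.Properties as Vecₚ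
open import Data.Vec.Relation.Unary.All using ([]; _∷_)
open import Data.Vec.Relation.Unary.All.Properties using (lookup⁺; lookup⁻)
open import Data.Vec.Relation.Unary.AllPairs using ([]; _∷_)
import Data.Vec.Relation.Unary.Any as Anyᵥ
open import Data.Vec.Relation.Unary.Any.Properties using (lookup-index)
open import Data.Vec.Relation.Unary.Unique.Propositional using () renaming (Unique to Uniqueᵥ)
open import Data.Vec.Relation.Unary.Unique.Propositional.Properties using (lookup-injective)
open import Function using (_∘_)
open import Function.Definitions using (Injective)
open import Relation.Binary.Definitions using (tri<; tri≈; tri>)
open import Relation.Binary.PropositionalEquality hiding ([_])
open import Relation.Nullary using (Dec; yes; no; does)
open import Relation.Nullary.Decidable using (dec-true; dec-false)
import Algebra.Properties.Semiring.Sum ℤₚ.+-*-semiring as FinSum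

-- Opaque copies of the operations: the library versions unfold during
-- unification, which then cannot infer summands.
infixl 6 _+_ _-_
infixl 7 _*_
infix 0 ∑

-- Count `L`, the five-vertex configurations (a, b, v, u, w) with u, w on the line of a and b, v off
-- it and vuw in N. If N is near a linear space, `L` has order n^5/t^3. The cherry inside a
-- configuration uses four vertices, and there are at most η n^4 cherries. A fifth vertex ranging
-- over all n vertices would only force η of order 1/t^3; it must be confined to O(n/t) choices,
-- which no codegree bound on N itself provides. Hence the cut, and hence the need that the total
-- cut off is again O(η n^3). The constant 12 is decided by t = 3. With Δ = t²η n³/t, that is
-- `t * E - n³`, the last estimate amounts to t Δ ≥ 45 t (t - 1) n³ / (273 t² + 240 t + 45). The
-- coefficient increases with t and is about 0.0838 at t = 3, just above 1/12; at t = 2 it is below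
-- 1/12, which is why that case has its own argument.

opaque
  _+_ _*_ _-_ : ℤ → ℤ → ℤ
  _+_ = ℤ._+_
  _*_ = ℤ._*_
  _-_ = ℤ._-_

  ∑ : ∀ {n} → (Fin n → ℤ) → ℤ
  ∑ = FinSum.sum

syntax ∑ (λ i → x) = ∑[ i ] x

0≤+n : ∀ {n} → 0ℤ ≤ + n
0≤+n = +≤+ z≤n

opaque
  unfolding _+_

  +-suc : ∀ k → +[1+ k ] ≡ 1ℤ + + k
  +-suc k = refl

  pos-+ : ∀ a b → + (a ℕ.+ b) ≡ + a + + b
  pos-+ = ℤₚ.pos-+

  pos-* : ∀ a b → + (a ℕ.* b) ≡ + a * + b
  pos-* = ℤₚ.pos-*

  pos-*³ : ∀ a b c → + (a ℕ.* (b ℕ.* c)) ≡ + a * (+ b * + c)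
  pos-*³ a b c = trans (ℤₚ.pos-* a (b ℕ.* c)) (cong (+ a ℤ.*_) (ℤₚ.pos-* b c))

  +-mono-≤ : ∀ {a b c d} → a ≤ b → c ≤ d → a + c ≤ b + d
  +-mono-≤ = ℤₚ.+-mono-≤

  0≤+ : ∀ {a b} → 0ℤ ≤ a → 0ℤ ≤ b → 0ℤ ≤ a + b
  0≤+ = ℤₚ.+-mono-≤

  0≤* : ∀ {a b} → 0ℤ ≤ a → 0ℤ ≤ b → 0ℤ ≤ a * b
  0≤* {+ a} {+ b} _ _ = subst (0ℤ ≤_) (ℤₚ.pos-* a b) 0≤+n

  0≤sq : ∀ a → 0ℤ ≤ a * a
  0≤sq (+ a)      = 0≤* {+ a} {+ a} 0≤+n 0≤+n
  0≤sq (-[1+ a ]) = 0≤+n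

  gap : ∀ {a b} → a ≤ b → 0ℤ ≤ b - a
  gap = ℤₚ.i≤j⇒0≤j-i

  by-gap : ∀ {a b} {d} → 0ℤ ≤ d → b - a ≡ d → a ≤ b
  by-gap p q = ℤₚ.0≤i-j⇒j≤i (subst (0ℤ ≤_) (sym q) p)

  -‿injective : ∀ {a b} → a - b ≡ 0ℤ → a ≡ b
  -‿injective = ℤₚ.i-j≡0⇒i≡j _ _

  *-monoˡ : ∀ {c a b} → 0ℤ ≤ c → a ≤ b → c * a ≤ c * b
  *-monoˡ {+ c} _ = ℤₚ.*-monoˡ-≤-nonNeg (+ c)

  *-cancelˡ : ∀ {c a b} → 0ℤ < c → c * a ≤ c * b → a ≤ b
  *-cancelˡ {+[1+ c ]} {a} {b} _ = ℤₚ.*-cancelˡ-≤-pos a b +[1+ c ]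
  *-cancelˡ {+ 0} (+<+ ())

  *-comm : ∀ a b → a * b ≡ b * a
  *-comm = ℤₚ.*-comm

  *-assoc : ∀ a b c → a * b * c ≡ a * (b * c)
  *-assoc = ℤₚ.*-assoc

  *-zeroˡ : ∀ a → 0ℤ * a ≡ 0ℤ
  *-zeroˡ = ℤₚ.*-zeroˡ

  *-zeroʳ : ∀ a → a * 0ℤ ≡ 0ℤ
  *-zeroʳ = ℤₚ.*-zeroʳ

  1* : ∀ a → 1ℤ * a ≡ a
  1* = ℤₚ.*-identityˡ

  *1 : ∀ a → a * 1ℤ ≡ a
  *1 = ℤₚ.*-identityʳ

-- Positive linear functionals and finite sums

record PosLinear {I : Set} (Λ : (I → ℤ) → ℤ) : Set where
  field
    Λ-cong : ∀ {f g} → (∀ i → f i ≡ g i) → Λ f ≡ Λ g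
    Λ-+    : ∀ f g → Λ (λ i → f i + g i) ≡ Λ f + Λ g
    Λ-*    : ∀ c f → Λ (λ i → c * f i) ≡ c * Λ f
    Λ-mono : ∀ {f g} → (∀ i → f i ≤ g i) → Λ f ≤ Λ g

  Λ-*ʳ : ∀ c f → Λ (λ i → f i * c) ≡ Λ f * c
  Λ-*ʳ c f = trans (Λ-cong (λ i → *-comm (f i) c)) (trans (Λ-* c f) (*-comm c (Λ f)))

  Λ-- : ∀ f g → Λ (λ i → f i - g i) ≡ Λ f - Λ g
  Λ-- f g = trans (Λ-cong (λ i → sub (f i) (g i))) (trans (Λ-+ f _) (trans (cong (_+_ (Λ f)) (Λ-* -1ℤ g)) (sym (sub (Λ f) (Λ g)))))
    where
    opaque
      unfolding _+_
      sub : ∀ a b → a - b ≡ a + -1ℤ * b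
      sub = solve-∀

  Λ-nonneg : ∀ {f} → (∀ i → 0ℤ ≤ f i) → 0ℤ ≤ Λ f
  Λ-nonneg {f} h = subst (_≤ Λ f) (trans (Λ-* 0ℤ f) (*-zeroˡ (Λ f))) (Λ-mono (λ i → subst (_≤ f i) (sym (*-zeroˡ (f i))) (h i)))

  -- Lagrange's identity: the double sum of w i * w j * (g i - g j)², nonnegative term by term, is
  -- twice the difference of the two sides; hence the factor 2 that is cancelled.
  cauchy-schwarz : ∀ {w} (g : I → ℤ) → (∀ i → 0ℤ ≤ w i) →
    Λ (λ i → w i * g i) * Λ (λ i → w i * g i) ≤ Λ w * Λ (λ i → w i * (g i * g i))
  cauchy-schwarz {w} g w≥0 = *-cancelˡ {+ 2} (+<+ (s≤s z≤n)) (by-gap nonneg (id₁ W S S₂))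
    where
    W = Λ w
    S = Λ (λ i → w i * g i)
    S₂ = Λ (λ i → w i * (g i * g i))
    opaque
      unfolding _+_
      id₁ : ∀ W S S₂ → + 2 * (W * S₂) - + 2 * (S * S) ≡ S₂ * W - S * (+ 2 * S) + W * S₂
      id₁ = solve-∀
      id₂ : ∀ wi wj gi gj → wi * wj * ((gi - gj) * (gi - gj)) ≡
            wi * (gi * gi) * wj - wi * gi * + 2 * (wj * gj) + wi * (wj * (gj * gj))
      id₂ = solve-∀
    id₃ : ∀ wi gi → (wi * (gi * gi)) * W - wi * gi * + 2 * S + wi * S₂ ≡
          (wi * (gi * gi)) * W - wi * gi * (+ 2 * S) + wi * S₂
    id₃ wi gi = cong (λ z → (wi * (gi * gi)) * W - z + wi * S₂) (*-assoc (wi * gi) (+ 2) S)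
    inner : ∀ i → Λ (λ j → w i * w j * ((g i - g j) * (g i - g j))) ≡
      (w i * (g i * g i)) * W - w i * g i * (+ 2 * S) + w i * S₂
    inner i = begin
      Λ (λ j → w i * w j * ((g i - g j) * (g i - g j)))
        ≡⟨ Λ-cong (λ j → id₂ (w i) (w j) (g i) (g j)) ⟩
      Λ (λ j → (w i * (g i * g i) * w j - w i * g i * + 2 * (w j * g j)) + w i * (w j * (g j * g j)))
        ≡⟨ Λ-+ _ _ ⟩
      Λ (λ j → w i * (g i * g i) * w j - w i * g i * + 2 * (w j * g j)) + Λ (λ j → w i * (w j * (g j * g j)))
        ≡⟨ cong₂ _+_ (trans (Λ-- _ _) (cong₂ _-_ (Λ-* _ _) (Λ-* _ _))) (Λ-* _ _) ⟩
      (w i * (g i * g i)) * W - w i * g i * + 2 * S + w i * S₂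
        ≡⟨ id₃ (w i) (g i) ⟩
      (w i * (g i * g i)) * W - w i * g i * (+ 2 * S) + w i * S₂ ∎
      where open ≡-Reasoning
    total : Λ (λ i → Λ (λ j → w i * w j * ((g i - g j) * (g i - g j)))) ≡ S₂ * W - S * (+ 2 * S) + W * S₂
    total = trans (Λ-cong inner) (trans (Λ-+ _ _)
      (cong₂ _+_ (trans (Λ-- _ _) (cong₂ _-_ (Λ-*ʳ _ _) (Λ-*ʳ _ _))) (Λ-*ʳ _ _)))
    nonneg : 0ℤ ≤ S₂ * W - S * (+ 2 * S) + W * S₂
    nonneg = subst (0ℤ ≤_) total (Λ-nonneg λ i → Λ-nonneg λ j →
      0≤* (0≤* (w≥0 i) (w≥0 j)) (0≤sq (g i - g j)))

opaque
  unfolding ∑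

  ∑-mono : ∀ {n} {f g : Fin n → ℤ} → (∀ i → f i ≤ g i) → ∑ f ≤ ∑ g
  ∑-mono {zero}  h = ≤-refl
  ∑-mono {suc n} h = ℤₚ.+-mono-≤ (h zero) (∑-mono (λ i → h (suc i)))

  ∑-comm : ∀ {m n} (f : Fin m → Fin n → ℤ) → (∑[ i ] ∑[ j ] f i j) ≡ (∑[ j ] ∑[ i ] f i j)
  ∑-comm = FinSum.∑-comm

  ∑-posLinear : ∀ {n} → PosLinear (∑ {n})
  ∑-posLinear = record
    { Λ-cong = λ h → FinSum.sum-cong-≋ h
    ; Λ-+ = FinSum.∑-distrib-+
    ; Λ-* = λ c f → sym (FinSum.*-distribˡ-sum c f)
    ; Λ-mono = ∑-mono }

  ∑-const : ∀ {n} c → (∑ {n} λ _ → c) ≡ + n * c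
  ∑-const {zero}  c = refl
  ∑-const {suc n} c = trans (cong (ℤ._+_ c) (∑-const {n} c)) (sym (ℤₚ.suc-* (+ n) c))

-- Pairs serve Cauchy-Schwarz over pairs of vertices; four- and five-fold sums serve pointwise
-- inequalities between indicators, which are summed once and then split into terms.
∘-posLinear : ∀ {I J : Set} {Λ : (I → ℤ) → ℤ} {M : (J → ℤ) → ℤ} → PosLinear Λ → PosLinear M →
  PosLinear (λ (f : I × J → ℤ) → Λ (λ i → M (λ j → f (i , j))))
∘-posLinear p q = record
  { Λ-cong = λ h → P.Λ-cong λ i → Q.Λ-cong λ j → h (i , j)
  ; Λ-+ = λ f g → trans (P.Λ-cong λ i → Q.Λ-+ _ _) (P.Λ-+ _ _)
  ; Λ-* = λ c f → trans (P.Λ-cong λ i → Q.Λ-* c _) (P.Λ-* c _)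
  ; Λ-mono = λ h → P.Λ-mono λ i → Q.Λ-mono λ j → h (i , j) }
  where module P = PosLinear p
        module Q = PosLinear q

open module ∑ₚ {n} = PosLinear (∑-posLinear {n}) public
  using () renaming (Λ-cong to ∑-cong; Λ-+ to ∑-+; Λ-* to ∑-*; Λ-*ʳ to ∑-*ʳ; Λ-- to ∑--; Λ-nonneg to ∑-nonneg; cauchy-schwarz to ∑-cauchy-schwarz)

⟦_⟧ : Bool → ℤ
⟦ true ⟧  = 1ℤ
⟦ false ⟧ = 0ℤ

0≤⟦_⟧ : ∀ b → 0ℤ ≤ ⟦ b ⟧
0≤⟦ true ⟧  = 0≤+n
0≤⟦ false ⟧ = 0≤+n

⟦_⟧≤1 : ∀ b → ⟦ b ⟧ ≤ 1ℤ
⟦ true ⟧≤1  = ≤-refl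
⟦ false ⟧≤1 = 0≤+n

0≤1-⟦_⟧ : ∀ b → 0ℤ ≤ 1ℤ - ⟦ b ⟧
0≤1-⟦ b ⟧ = gap ⟦ b ⟧≤1

-- Weighted graphs

module Graph {n : ℕ} (A : Fin n → Fin n → Bool) (A-sym : ∀ x y → A x y ≡ A y x) where

  a : Fin n → Fin n → ℤ
  a x y = ⟦ A x y ⟧

  a-sym : ∀ x y → a x y ≡ a y x
  a-sym x y = cong ⟦_⟧ (A-sym x y)

  Independent : List (Fin n) → Set
  Independent = AllPairs (λ x y → A x y ≡ false)

  NoIndependent : ℕ → (Fin n → ℤ) → Set
  NoIndependent k f = ∀ xs → length xs ≡ k → Independent xs → All (λ x → 0ℤ < f x) xs → ⊥

  module _ (f : Fin n → ℤ) where
    deg : Fin n → ℤ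
    deg x = ∑[ y ] a x y * f y

    total energy degSq : ℤ
    total  = ∑ f
    energy = ∑[ x ] f x * deg x
    degSq  = ∑[ x ] f x * (deg x * deg x)

    pathsFrom : Fin n → ℤ
    pathsFrom x = ∑[ y ] ∑[ z ] f y * (f z * (a y z * (a x z * (1ℤ - a x y))))

    cherries : ℤ
    cherries = ∑[ x ] f x * pathsFrom x

    away : Fin n → Fin n → ℤ
    away x y = f y * (1ℤ - a x y)

  module _ (f : Fin n → ℤ) (f≥0 : ∀ x → 0ℤ ≤ f x) where
    private
      F = total f
      d = deg f
      e = energy f

    deg-nonneg : ∀ x → 0ℤ ≤ d x
    deg-nonneg x = ∑-nonneg λ y → 0≤* 0≤⟦ A x y ⟧ (f≥0 y)

    energy-nonneg : 0ℤ ≤ e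
    energy-nonneg = ∑-nonneg λ x → 0≤* (f≥0 x) (deg-nonneg x)

    deg≤total : ∀ x → d x ≤ F
    deg≤total x = ∑-mono λ y → by-gap (0≤* 0≤1-⟦ A x y ⟧ (f≥0 y)) (i (f y) (a x y))
      where
      opaque
        unfolding _+_
        i : ∀ p q → p - q * p ≡ (1ℤ - q) * p
        i = solve-∀

    energy≤total² : e ≤ F * F
    energy≤total² = subst (e ≤_) (∑-*ʳ F f) (∑-mono λ x → *-monoˡ (f≥0 x) (deg≤total x))

    away-nonneg : ∀ x y → 0ℤ ≤ away f x y
    away-nonneg x y = 0≤* (f≥0 y) 0≤1-⟦ A x y ⟧

    total-away : ∀ x → total (away f x) ≡ F - d x
    total-away x = trans (∑-cong λ y → i (f y) (a x y)) (∑-- _ _)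
      where
      opaque
        unfolding _+_
        i : ∀ p q → p * (1ℤ - q) ≡ p - q * p
        i = solve-∀

    -- Two deletions: removing the neighbours y of x as first ends of the pairs yz costs their
    -- weighted degrees; removing then the pairs whose second end z is adjacent to x costs the paths
    -- y - z - x with y, x nonadjacent. Cherries enter through this second loss.
    energy-away : ∀ x → energy (away f x) ≡ e - (∑[ y ] a x y * (f y * d y)) - pathsFrom f x
    energy-away x = begin
      (∑[ y ] away f x y * deg (away f x) y)
        ≡⟨ ∑-cong (λ y → trans (sym (∑-* _ _)) (trans (∑-cong (λ z → i (f y) (f z) (a y z) (a x y) (a x z)))
             (trans (∑-- _ _) (cong₂ _-_ (trans (∑-- _ _) (cong₂ _-_ (∑-* _ _) (trans (∑-* _ _) (cong (a x y *_) (∑-* _ _))))) refl)))) ⟩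
      (∑[ y ] (f y * d y - a x y * (f y * d y) - (∑[ z ] f y * (f z * (a y z * (a x z * (1ℤ - a x y)))))))
        ≡⟨ trans (∑-- _ _) (cong₂ _-_ (∑-- _ _) refl) ⟩
      e - (∑[ y ] a x y * (f y * d y)) - pathsFrom f x ∎
      where
      open ≡-Reasoning
      opaque
        unfolding _+_
        i : ∀ fy fz ayz axy axz → fy * (1ℤ - axy) * (ayz * (fz * (1ℤ - axz))) ≡
            fy * (ayz * fz) - axy * (fy * (ayz * fz)) - fy * (fz * (ayz * (axz * (1ℤ - axy))))
        i = solve-∀

    ∑-energy-away : (∑[ x ] f x * energy (away f x)) ≡ F * e - degSq f - cherries f
    ∑-energy-away = begin
      (∑[ x ] f x * energy (away f x))
        ≡⟨ ∑-cong (λ x → trans (cong (f x *_) (energy-away x)) (i (f x) e _ _)) ⟩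
      (∑[ x ] (f x * e - f x * (∑[ y ] a x y * (f y * d y)) - f x * pathsFrom f x))
        ≡⟨ trans (∑-- _ _) (cong₂ _-_ (trans (∑-- _ _) (cong₂ _-_ (∑-*ʳ e f) sq)) refl) ⟩
      F * e - degSq f - cherries f ∎
      where
      open ≡-Reasoning
      opaque
        unfolding _+_
        i : ∀ p e q r → p * (e - q - r) ≡ p * e - p * q - p * r
        i = solve-∀
        j : ∀ fx axy fy dy → fx * (axy * (fy * dy)) ≡ fy * dy * (axy * fx)
        j = solve-∀
        k : ∀ fy dy → fy * dy * dy ≡ fy * (dy * dy)
        k = solve-∀
      sq : (∑[ x ] f x * (∑[ y ] a x y * (f y * d y))) ≡ degSq f
      sq = begin
        (∑[ x ] f x * (∑[ y ] a x y * (f y * d y)))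
          ≡⟨ ∑-cong (λ x → trans (sym (∑-* _ _)) (∑-cong λ y →
               trans (cong (λ q → f x * (q * (f y * d y))) (a-sym x y)) (j (f x) (a y x) (f y) (d y)))) ⟩
        (∑[ x ] ∑[ y ] f y * d y * (a y x * f x))
          ≡⟨ ∑-comm (λ x y → f y * d y * (a y x * f x)) ⟩
        (∑[ y ] ∑[ x ] f y * d y * (a y x * f x))
          ≡⟨ ∑-cong (λ y → trans (∑-* _ _) (k (f y) (d y))) ⟩
        degSq f ∎

    ∑-total-away² : (∑[ x ] f x * (total (away f x) * total (away f x))) ≡ F * (F * F) - + 2 * F * e + degSq f
    ∑-total-away² = begin
      (∑[ x ] f x * (total (away f x) * total (away f x)))
        ≡⟨ ∑-cong (λ x → trans (cong (λ q → f x * (q * q)) (total-away x)) (i (f x) F (d x))) ⟩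
      (∑[ x ] (f x * (F * F) - + 2 * F * (f x * d x) + f x * (d x * d x)))
        ≡⟨ trans (∑-+ _ _) (cong₂ _+_ (trans (∑-- _ _) (cong₂ _-_ (∑-*ʳ _ f) (∑-* _ _))) refl) ⟩
      F * (F * F) - + 2 * F * e + degSq f ∎
      where
      open ≡-Reasoning
      opaque
        unfolding _+_
        i : ∀ p F d → p * ((F - d) * (F - d)) ≡ p * (F * F) - + 2 * F * (p * d) + p * (d * d)
        i = solve-∀

  NoIndependent-away : ∀ {k f} x → (∀ y → 0ℤ ≤ f y) → 0ℤ < f x → NoIndependent (suc k) f → NoIndependent k (away f x)
  NoIndependent-away {k} {f} x f≥0 fx>0 none xs len ind pos =
    none (x ∷ xs) (cong suc len) (All.map (λ {y} → nonadj y) pos ∷ ind) (fx>0 ∷ All.map (λ {y} → supp y) pos)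
    where
    opaque
      unfolding _+_
      vanish : ∀ p → p * (1ℤ - 1ℤ) ≡ 0ℤ
      vanish = solve-∀
    nonadj : ∀ y → 0ℤ < away f x y → A x y ≡ false
    nonadj y p with A x y
    ... | false = refl
    ... | true  = ⊥-elim (<-irrefl (sym (vanish (f y))) p)
    supp : ∀ y → 0ℤ < away f x y → 0ℤ < f y
    supp y p with f y | f≥0 y
    ... | +[1+ _ ] | _ = +<+ (s≤s z≤n)
    ... | + 0      | _ = ⊥-elim (<-irrefl (sym (*-zeroˡ _)) p)

  mutual
    motzkin-straus : ∀ t (f : Fin n → ℤ) → (∀ x → 0ℤ ≤ f x) → NoIndependent (suc t) f →
      total f * total f ≤ + t * energy f
    motzkin-straus zero f f≥0 none =
      ≤-reflexive (trans (cong (λ q → q * q) (trans (∑-cong f≡0) (trans (∑-const {n} 0ℤ) (*-zeroʳ (+ n)))))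
        (trans (*-zeroˡ 0ℤ) (sym (*-zeroˡ (energy f)))))
      where
      f≡0 : ∀ x → f x ≡ 0ℤ
      f≡0 x with f x in eq | f≥0 x
      ... | + 0      | _ = refl
      ... | +[1+ m ] | _ = ⊥-elim (none (x ∷ []) refl ([] ∷ []) (subst (0ℤ <_) (sym eq) (+<+ (s≤s z≤n)) ∷ []))
    motzkin-straus (suc k) f f≥0 none rewrite +-suc k with energy f ≟ total f * total f
    -- The other case cancels F * F - e; where that factor vanishes, the claim is just e ≤ (1 + k) *
    -- e.
    ... | yes e≡F² = by-gap (0≤* {+ k} 0≤+n (energy-nonneg f f≥0))
                       (trans (cong (λ q → (1ℤ + + k) * e - q) (sym e≡F²)) (i (+ k) e))
      where e = energy f
            opaque
              unfolding _+_
              i : ∀ k e → (1ℤ + k) * e - e ≡ k * e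
              i = solve-∀
    -- Multiplied by F * F - e, the gap splits into F times the gap of `cherry-bound`, (1 + k) times
    -- the Cauchy-Schwarz gap for the degrees, and a nonnegative multiple of the cherries.
    ... | no e≢F² = *-cancelˡ (≤∧≢⇒< (gap (energy≤total² f f≥0)) λ q → e≢F² (sym (-‿injective (sym q))))
                      (by-gap (0≤+ (0≤* (total-nonneg) (gap (cherry-bound k f f≥0 none)))
                                 (0≤+ (0≤* (0≤+ {1ℤ} {+ k} 0≤+n 0≤+n) (gap (∑-cauchy-schwarz d f≥0)))
                                      (0≤* (0≤* (total-nonneg) (0≤+n {k})) cherries-nonneg)))
                        (i (+ k) F e (degSq f) (cherries f)))
      where
      F = total f
      e = energy f
      d = deg f
      total-nonneg : 0ℤ ≤ F
      total-nonneg = ∑-nonneg f≥0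
      cherries-nonneg : 0ℤ ≤ cherries f
      cherries-nonneg = ∑-nonneg λ x → 0≤* (f≥0 x) (∑-nonneg λ y → ∑-nonneg λ z →
        0≤* (f≥0 y) (0≤* (f≥0 z) (0≤* 0≤⟦ A y z ⟧ (0≤* 0≤⟦ A x z ⟧ 0≤1-⟦ A x y ⟧))))
      opaque
        unfolding _+_
        i : ∀ k F e S B → (F * F - e) * ((1ℤ + k) * e) - (F * F - e) * (F * F) ≡
            F * ((+ 2 + k) * (F * e) - ((1ℤ + k) * S + F * (F * F) + k * B)) + ((1ℤ + k) * (F * S - e * e) + F * k * B)
        i = solve-∀

    -- Among the non-neighbours of a vertex x of positive weight no k + 1 are independent, so
    -- `motzkin-straus k` applies to `away f x`. Weighting by f x, summing over x and expanding both
    -- sides gives the claim, with the cherries retained.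
    cherry-bound : ∀ k (f : Fin n → ℤ) → (∀ x → 0ℤ ≤ f x) → NoIndependent (suc (suc k)) f →
      (1ℤ + + k) * degSq f + total f * (total f * total f) + + k * cherries f ≤ (+ 2 + + k) * (total f * energy f)
    cherry-bound k f f≥0 none = by-gap (gap summed) (trans (i (+ k) F e (degSq f) (cherries f))
        (sym (cong₂ (λ p q → + k * p - q) (∑-energy-away f f≥0) (∑-total-away² f f≥0))))
      where
      F = total f
      e = energy f
      local : ∀ x → f x * (total (away f x) * total (away f x)) ≤ + k * (f x * energy (away f x))
      local x with 0ℤ <? f x
      ... | yes fx>0 = ≤-trans (*-monoˡ (f≥0 x) (motzkin-straus k (away f x) (away-nonneg f f≥0 x)
                         (NoIndependent-away x f≥0 fx>0 none))) (≤-reflexive (j (f x) (+ k) _))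
        where
        opaque
          unfolding _+_
          j : ∀ p k e → p * (k * e) ≡ k * (p * e)
          j = solve-∀
      ... | no fx≯0 rewrite ≤-antisym (≮⇒≥ fx≯0) (f≥0 x) =
        ≤-reflexive (trans (*-zeroˡ _) (sym (trans (cong (+ k *_) (*-zeroˡ _)) (*-zeroʳ (+ k)))))
      summed : (∑[ x ] f x * (total (away f x) * total (away f x))) ≤ + k * (∑[ x ] f x * energy (away f x))
      summed = ≤-trans (∑-mono local) (≤-reflexive (∑-* (+ k) _))
      opaque
        unfolding _+_
        i : ∀ k F e S B → (+ 2 + k) * (F * e) - ((1ℤ + k) * S + F * (F * F) + k * B) ≡
            k * (F * e - S - B) - (F * (F * F) - + 2 * F * e + S)
        i = solve-∀

module GraphCount {n : ℕ} (A : Fin n → Fin n → Bool) (A-sym : ∀ x y → A x y ≡ A y x) where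
  open Graph A A-sym

  degree : Fin n → ℤ
  degree x = ∑[ y ] a x y

  -- On each edge 2 f(x) f(y) ≤ f(x)² + f(y)². Motzkin-Straus thereby becomes linear in the degrees,
  -- so that `link-excess` can treat each codegree separately.
  energy-upper : ∀ (f : Fin n → ℤ) → energy f ≤ (∑[ x ] f x * f x * degree x)
  energy-upper f = *-cancelˡ {+ 2} (+<+ (s≤s z≤n)) (≤-trans (≤-reflexive lhs) (≤-trans (∑-mono λ x → ∑-mono λ y → am x y) (≤-reflexive rhs)))
    where
    lhs : + 2 * energy f ≡ (∑[ x ] ∑[ y ] + 2 * (f x * (a x y * f y)))
    lhs = trans (sym (∑-* (+ 2) _)) (∑-cong λ x → trans (cong (+ 2 *_) (sym (∑-* (f x) _))) (sym (∑-* (+ 2) _)))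
    opaque
      unfolding _+_
      i : ∀ p q r → p * (q * q) + p * (r * r) - + 2 * (q * (p * r)) ≡ p * ((q - r) * (q - r))
      i = solve-∀
      j : ∀ p → p + p ≡ + 2 * p
      j = solve-∀
    am : ∀ x y → + 2 * (f x * (a x y * f y)) ≤ a x y * (f x * f x) + a x y * (f y * f y)
    am x y = by-gap (0≤* 0≤⟦ A x y ⟧ (0≤sq (f x - f y))) (i (a x y) (f x) (f y))
    own : (∑[ x ] ∑[ y ] a x y * (f x * f x)) ≡ (∑[ x ] f x * f x * degree x)
    own = ∑-cong λ x → trans (∑-*ʳ _ _) (*-comm _ _)
    other : (∑[ x ] ∑[ y ] a x y * (f y * f y)) ≡ (∑[ x ] f x * f x * degree x)
    other = trans (∑-comm _) (trans (∑-cong λ y → ∑-cong λ x → cong (_* (f y * f y)) (a-sym x y)) own)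
    rhs : (∑[ x ] ∑[ y ] (a x y * (f x * f x) + a x y * (f y * f y))) ≡ + 2 * (∑[ x ] f x * f x * degree x)
    rhs = trans (∑-cong λ x → ∑-+ _ _) (trans (∑-+ _ _) (trans (cong₂ _+_ own other) (j _)))

  cherry-bound₁ : ∀ k → (∀ xs → length xs ≡ suc (suc k) → Independent xs → ⊥) →
    (1ℤ + + k) * (∑[ x ] degree x * degree x) + + n * (+ n * + n)
      + + k * (∑[ x ] ∑[ y ] ∑[ z ] a y z * (a x z * (1ℤ - a x y))) ≤ (+ 2 + + k) * (+ n * (∑[ x ] degree x))
  cherry-bound₁ k none = subst₂ _≤_
    (cong₂ _+_ (cong₂ _+_ (cong ((1ℤ + + k) *_) degSq₁) (cong (λ q → q * (q * q)) total₁)) (cong (+ k *_) cherries₁))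
    (cong ((+ 2 + + k) *_) (cong₂ _*_ total₁ energy₁))
    (cherry-bound k one (λ _ → 0≤+n) (λ xs l i _ → none xs l i))
    where
    one : Fin n → ℤ
    one _ = 1ℤ
    deg₁ : ∀ x → deg one x ≡ degree x
    deg₁ x = ∑-cong λ y → *1 _
    total₁ : total one ≡ + n
    total₁ = trans (∑-const 1ℤ) (*1 _)
    energy₁ : energy one ≡ (∑[ x ] degree x)
    energy₁ = ∑-cong λ x → trans (1* _) (deg₁ x)
    degSq₁ : degSq one ≡ (∑[ x ] degree x * degree x)
    degSq₁ = ∑-cong λ x → trans (1* _) (cong (λ q → q * q) (deg₁ x))
    cherries₁ : cherries one ≡ (∑[ x ] ∑[ y ] ∑[ z ] a y z * (a x z * (1ℤ - a x y)))
    cherries₁ = ∑-cong λ x → trans (1* _) (∑-cong λ y → ∑-cong λ z → trans (1* _) (1* _))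

-- Triple systems

module Triple {n : ℕ} (N : Fin n → Fin n → Fin n → Bool)
  (N-sym₁ : ∀ x y z → N x y z ≡ N y x z) (N-sym₂ : ∀ x y z → N x y z ≡ N x z y)
  (t : ℕ) (none : ∀ v xs → length xs ≡ suc t → AllPairs (λ x y → N v x y ≡ false) xs → ⊥) where

  ν : Fin n → Fin n → Fin n → ℤ
  ν x y z = ⟦ N x y z ⟧

  ν₁ : ∀ x y z → ν x y z ≡ ν y x z
  ν₁ x y z = cong ⟦_⟧ (N-sym₁ x y z)

  ν₂ : ∀ x y z → ν x y z ≡ ν x z y
  ν₂ x y z = cong ⟦_⟧ (N-sym₂ x y z)

  module G v = Graph (N v) (N-sym₂ v)

  c : Fin n → Fin n → ℤ
  c x y = ∑[ z ] ν x y z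

  c-nonneg : ∀ x y → 0ℤ ≤ c x y
  c-nonneg x y = ∑-nonneg λ z → 0≤⟦ N x y z ⟧

  cherry : Fin n → Fin n → Fin n → Fin n → ℤ
  cherry v x y z = ν v y z * (ν v x z * (1ℤ - ν v x y))

  cherry-nonneg : ∀ v x y z → 0ℤ ≤ cherry v x y z
  cherry-nonneg v x y z = 0≤* 0≤⟦ N v y z ⟧ (0≤* 0≤⟦ N v x z ⟧ 0≤1-⟦ N v x y ⟧)

  E Q B : ℤ
  E = ∑[ x ] ∑[ y ] c x y
  Q = ∑[ x ] ∑[ y ] c x y * c x y
  B = ∑[ v ] ∑[ x ] ∑[ y ] ∑[ z ] cherry v x y z

  B-nonneg : 0ℤ ≤ B
  B-nonneg = ∑-nonneg λ v → ∑-nonneg λ x → ∑-nonneg λ y → ∑-nonneg λ z → cherry-nonneg v x y z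

  E≤n³ : E ≤ + n * (+ n * + n)
  E≤n³ = ≤-trans (∑-mono λ x → ∑-mono λ y → ∑-mono λ z → ⟦ N x y z ⟧≤1)
    (≤-reflexive (trans (∑-cong λ x → trans (∑-cong λ y → trans (∑-const 1ℤ) (*1 _)) (∑-const _)) (∑-const _)))

  E²≤n²Q : E * E ≤ + n * + n * Q
  E²≤n²Q = subst₂ _≤_ (cong (λ q → q * q) (∑-cong λ x → ∑-cong λ y → 1* _))
      (cong₂ _*_ (trans (∑-cong λ x → trans (∑-const 1ℤ) (*1 _)) (∑-const _)) (∑-cong λ x → ∑-cong λ y → 1* _))
    (PosLinear.cauchy-schwarz (∘-posLinear (∑-posLinear {n}) (∑-posLinear {n})) {w = λ _ → 1ℤ} (λ (x , y) → c x y) (λ _ → 0≤+n))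

  link-cherry-bound : ∀ k → t ≡ suc k →
    (1ℤ + + k) * Q + + n * (+ n * (+ n * + n)) + + k * B ≤ (+ 2 + + k) * (+ n * E)
  link-cherry-bound k refl = subst₂ _≤_
    (trans (∑-+ _ _) (cong₂ _+_ (trans (∑-+ _ _) (cong₂ _+_ (∑-* _ _) (∑-const _))) (∑-* _ _)))
    (trans (∑-* _ _) (cong ((+ 2 + + k) *_) (∑-* _ _)))
    (∑-mono λ v → GraphCount.cherry-bound₁ (N v) (N-sym₂ v) k (none v))

  -- Every 4-tuple satisfies (1 - p)(1 - q - r - s + qr + rs + qs) ≥ 0, where p, q, r, s are the indicators of its triples.
  four-point : 0ℤ ≤ + n * (+ n * (+ n * + n)) - + 4 * (+ n * E) + + 3 * Q + + 3 * B
  four-point = subst (0ℤ ≤_) eq (Λ-nonneg λ (v , x , y , z) → pt (N v x y) (N v y z) (N v x z) (N x y z))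
    where
    ∑₄ : (Fin n × (Fin n × (Fin n × Fin n)) → ℤ) → ℤ
    ∑₄ g = ∑[ v ] ∑[ x ] ∑[ y ] ∑[ z ] g (v , x , y , z)
    Σp : PosLinear (∑ {n})
    Σp = ∑-posLinear
    open PosLinear (∘-posLinear Σp (∘-posLinear Σp (∘-posLinear Σp Σp)))
    pt : ∀ p q r s → 0ℤ ≤ (1ℤ - ⟦ p ⟧ - ⟦ q ⟧ - ⟦ r ⟧ - ⟦ s ⟧ + ⟦ p ⟧ * ⟦ q ⟧ + ⟦ p ⟧ * ⟦ r ⟧ + ⟦ p ⟧ * ⟦ s ⟧)
         + ⟦ q ⟧ * (⟦ r ⟧ * (1ℤ - ⟦ p ⟧)) + ⟦ s ⟧ * (⟦ r ⟧ * (1ℤ - ⟦ p ⟧)) + ⟦ s ⟧ * (⟦ q ⟧ * (1ℤ - ⟦ p ⟧))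
    pt p q r s = subst (0ℤ ≤_) (i ⟦ p ⟧ ⟦ q ⟧ ⟦ r ⟧ ⟦ s ⟧) (0≤* 0≤1-⟦ p ⟧ (qrs q r s))
      where
      opaque
        unfolding _+_
        i : ∀ p q r s → (1ℤ - p) * (1ℤ - q - r - s + q * r + s * r + s * q) ≡
            (1ℤ - p - q - r - s + p * q + p * r + p * s) + q * (r * (1ℤ - p)) + s * (r * (1ℤ - p)) + s * (q * (1ℤ - p))
        i = solve-∀
        -- With j of q, r, s true the value is (j - 1)(j - 2)/2, nonnegative for every integer j.
        qrs : ∀ q r s → 0ℤ ≤ 1ℤ - ⟦ q ⟧ - ⟦ r ⟧ - ⟦ s ⟧ + ⟦ q ⟧ * ⟦ r ⟧ + ⟦ s ⟧ * ⟦ r ⟧ + ⟦ s ⟧ * ⟦ q ⟧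
        qrs true true true = 0≤+n
        qrs true true false = 0≤+n
        qrs true false true = 0≤+n
        qrs true false false = 0≤+n
        qrs false true true = 0≤+n
        qrs false true false = 0≤+n
        qrs false false true = 0≤+n
        qrs false false false = 0≤+n
    ∑1 : ∑₄ (λ _ → 1ℤ) ≡ + n * (+ n * (+ n * + n))
    ∑1 = trans (∑-cong λ v → trans (∑-cong λ x → trans (∑-cong λ y → trans (∑-const 1ℤ) (*1 _)) (∑-const _)) (∑-const _)) (∑-const _)
    ∑s : ∑₄ (λ (v , x , y , z) → ν x y z) ≡ + n * E
    ∑s = ∑-const E
    ∑q : ∑₄ (λ (v , x , y , z) → ν v y z) ≡ + n * E
    ∑q = trans (∑-cong λ v → ∑-const (∑[ y ] c v y)) (∑-* _ _)
    ∑r : ∑₄ (λ (v , x , y , z) → ν v x z) ≡ + n * E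
    ∑r = trans (∑-cong λ v → trans (∑-cong λ x → ∑-const (c v x)) (∑-* _ _)) (∑-* _ _)
    ∑p : ∑₄ (λ (v , x , y , z) → ν v x y) ≡ + n * E
    ∑p = trans (∑-cong λ v → trans (∑-cong λ x → trans (∑-cong λ y → ∑-const (ν v x y)) (∑-* _ _)) (∑-* _ _)) (∑-* _ _)
    sq : ∀ {f : Fin n → ℤ} → (∑[ x ] ∑[ z ] f x * f z) ≡ ∑ f * ∑ f
    sq = trans (∑-cong λ x → ∑-* _ _) (∑-*ʳ _ _)
    ∑pr : ∑₄ (λ (v , x , y , z) → ν v x y * ν v x z) ≡ Q
    ∑pr = ∑-cong λ v → ∑-cong λ x → sq
    ∑pq : ∑₄ (λ (v , x , y , z) → ν v x y * ν v y z) ≡ Q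
    ∑pq = trans (∑-cong λ v → trans (∑-cong λ x → ∑-cong λ y → ∑-cong λ z → cong (_* ν v y z) (ν₂ v x y)) (∑-comm _)) ∑pr
    ∑ps : ∑₄ (λ (v , x , y , z) → ν v x y * ν x y z) ≡ Q
    ∑ps = trans (∑-cong λ v → ∑-cong λ x → ∑-cong λ y → ∑-cong λ z → cong (_* ν x y z) (ν₁ v x y)) (trans (∑-comm _) ∑pq)
    ∑qr : ∑₄ (λ (v , x , y , z) → ν v y z * (ν v x z * (1ℤ - ν v x y))) ≡ B
    ∑qr = refl
    ∑sr : ∑₄ (λ (v , x , y , z) → ν x y z * (ν v x z * (1ℤ - ν v x y))) ≡ B
    ∑sr = trans (∑-cong λ v → ∑-cong λ x → ∑-cong λ y → ∑-cong λ z →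
            cong (ν x y z *_) (cong₂ (λ p q → p * (1ℤ - q)) (ν₁ v x z) (ν₁ v x y))) (∑-comm _)
    ∑sq : ∑₄ (λ (v , x , y , z) → ν x y z * (ν v y z * (1ℤ - ν v x y))) ≡ B
    ∑sq = trans (∑-cong λ v → trans (∑-cong λ x → ∑-cong λ y → ∑-cong λ z →
            cong₂ (λ p q → p * (ν v y z * (1ℤ - q))) (ν₁ x y z) (ν₂ v x y)) (∑-comm _)) ∑sr
    eq = trans (Λ-+ _ _) (trans (cong₂ _+_ (trans (Λ-+ _ _) (cong₂ _+_ (trans (Λ-+ _ _) (cong₂ _+_
           (trans (Λ-+ _ _) (cong₂ _+_ (trans (Λ-+ _ _) (cong₂ _+_ (trans (Λ-+ _ _) (cong₂ _+_
             (trans (Λ-- _ _) (cong₂ _-_ (trans (Λ-- _ _) (cong₂ _-_ (trans (Λ-- _ _) (cong₂ _-_ (trans (Λ-- _ _) (cong₂ _-_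
               ∑1 ∑p)) ∑q)) ∑r)) ∑s)) ∑pq)) ∑pr)) ∑ps)) ∑qr)) ∑sr)) ∑sq) (i (+ n * (+ n * (+ n * + n))) (+ n * E) Q B))
      where
      opaque
        unfolding _+_
        i : ∀ n⁴ e q b → (n⁴ - e - e - e - e + q + q + q) + b + b + b ≡ n⁴ - + 4 * e + + 3 * q + + 3 * b
        i = solve-∀

-- Truncated neighbourhoods and configurations on five vertices

truncate : ∀ {n} → ℕ → (Fin n → Bool) → Fin n → Bool
truncate zero    h i       = false
truncate (suc m) h zero    = h zero
truncate (suc m) h (suc i) with h zero
... | true  = truncate m (λ j → h (suc j)) i
... | false = truncate (suc m) (λ j → h (suc j)) i

truncate-⊆ : ∀ {n} m (h : Fin n → Bool) i → truncate m h i ≡ true → h i ≡ true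
truncate-⊆ (suc m) h zero    p = p
truncate-⊆ (suc m) h (suc i) p with h zero
... | true  = truncate-⊆ m (λ j → h (suc j)) i p
... | false = truncate-⊆ (suc m) (λ j → h (suc j)) i p

opaque
  unfolding ∑

  ∑-truncate-≤ : ∀ {n} m (h : Fin n → Bool) → (∑[ i ] ⟦ truncate m h i ⟧) ≤ + m
  ∑-truncate-≤ {zero}  m       h = 0≤+n
  ∑-truncate-≤ {suc n} zero    h = ≤-trans (≤-reflexive (ℤₚ.+-identityˡ _)) (∑-truncate-≤ {n} zero (λ j → h (suc j)))
  ∑-truncate-≤ {suc n} (suc m) h with h zero
  ... | true  = ℤₚ.+-monoʳ-≤ 1ℤ (∑-truncate-≤ m (λ j → h (suc j)))
  ... | false = ≤-trans (≤-reflexive (ℤₚ.+-identityˡ _)) (∑-truncate-≤ (suc m) (λ j → h (suc j)))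

  ∑-truncate : ∀ {n} m (h : Fin n → Bool) →
    (∑[ i ] ⟦ truncate m h i ⟧) ≡ (∑[ i ] ⟦ h i ⟧) ⊎ (∑[ i ] ⟦ truncate m h i ⟧) ≡ + m
  ∑-truncate {n}     zero    h = inj₂ (trans (∑-const {n} 0ℤ) (*-zeroʳ (+ n)))
  ∑-truncate {zero}  (suc m) h = inj₁ refl
  ∑-truncate {suc n} (suc m) h with h zero
  ... | true with ∑-truncate m (λ j → h (suc j))
  ...   | inj₁ p = inj₁ (cong (ℤ._+_ 1ℤ) p)
  ...   | inj₂ p = inj₂ (cong (ℤ._+_ 1ℤ) p)
  ∑-truncate {suc n} (suc m) h | false with ∑-truncate (suc m) (λ j → h (suc j))
  ...   | inj₁ p = inj₁ (cong (ℤ._+_ 0ℤ) p)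
  ...   | inj₂ p = inj₂ (trans (ℤₚ.+-identityˡ _) p)

module Truncated {n : ℕ} (N : Fin n → Fin n → Fin n → Bool)
  (N-sym₁ : ∀ x y z → N x y z ≡ N y x z) (N-sym₂ : ∀ x y z → N x y z ≡ N x z y)
  (t : ℕ) (none : ∀ v xs → length xs ≡ suc t → AllPairs (λ x y → N v x y ≡ false) xs → ⊥)
  (m : ℕ) (m-large : + 4 * + n ≤ + 3 * (+ t * + m)) where

  open Triple N N-sym₁ N-sym₂ t none

  T : Fin n → Fin n → Fin n → Bool
  T x y = truncate m (N x y)

  θ : Fin n → Fin n → Fin n → ℤ
  θ x y z = ⟦ T x y z ⟧

  τ Z : Fin n → Fin n → ℤ
  τ x y = ∑[ z ] θ x y z
  Z x y = ∑[ z ] (ν x y z - θ x y z)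

  τ≤m : ∀ x y → τ x y ≤ + m
  τ≤m x y = ∑-truncate-≤ m (N x y)

  Z≡c-τ : ∀ x y → Z x y ≡ c x y - τ x y
  Z≡c-τ x y = ∑-- _ _

  θ≤ν : ∀ x y z → 0ℤ ≤ ν x y z - θ x y z
  θ≤ν x y z with T x y z in eq
  ... | true  rewrite truncate-⊆ m (N x y) z eq = gap {1ℤ} ≤-refl
  ... | false = gap 0≤⟦ N x y z ⟧

  Z-nonneg : ∀ x y → 0ℤ ≤ Z x y
  Z-nonneg x y = ∑-nonneg λ z → θ≤ν x y z

  Ztot Δ : ℤ
  Ztot = ∑[ x ] ∑[ y ] Z x y
  Δ = + t * E - + n * (+ n * + n)

  Ztot-nonneg : 0ℤ ≤ Ztot
  Ztot-nonneg = ∑-nonneg λ x → ∑-nonneg λ y → Z-nonneg x y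

  -- Motzkin–Straus with weight 2 on the vertices x whose codegree with v is not truncated and weight 1 on the others.
  link-excess : ∀ v → + 3 * + t * (∑[ x ] Z v x) ≤ (∑[ x ] (+ 4 * (+ t * c v x) - + 4 * + n))
  link-excess v = ≤-trans (≤-reflexive (sym (∑-* _ _))) (≤-trans (∑-mono λ x → local x (∑-truncate m (N v x)))
      (≤-trans (≤-reflexive (∑-- _ _)) (by-gap lower (i _ _))))
    where
    wt : ∀ {x} → (τ v x ≡ c v x ⊎ τ v x ≡ + m) → ℤ
    wt (inj₁ _) = + 2
    wt (inj₂ _) = 1ℤ
    f : Fin n → ℤ
    f x = wt {x} (∑-truncate m (N v x))
    wt≥0 : ∀ {x} (p : τ v x ≡ c v x ⊎ τ v x ≡ + m) → 0ℤ ≤ wt {x} p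
    wt≥0 (inj₁ _) = 0≤+n
    wt≥0 (inj₂ _) = 0≤+n
    -- Summed over x, the subtracted part is the tangent to the square at 2n, 4n * F - 4n² for total
    -- weight F. By Motzkin-Straus the costs therefore add up to at least (F - 2n)².
    cost : ℤ → ℤ → ℤ
    cost w d = + t * (w * w * d) - (+ 4 * + n * w - + 4 * + n)
    opaque
      unfolding _+_
      i : ∀ p q → p - (p - q) ≡ q
      i = solve-∀
      light : ∀ t n d → (+ 4 * (t * d) - + 4 * n) - (t * (+ 2 * + 2 * d) - (+ 4 * n * + 2 - + 4 * n)) ≡ + 3 * t * (d - d)
      light = solve-∀
      -- At weight 1 the vertex leaves 3t * d - 4n, which is at least 3t * (d - m) exactly when 3t *
      -- m ≥ 4n: the origin of the level 4n/(3t). At weight 2 nothing is left.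
      heavy : ∀ t n d m → ((+ 4 * (t * d) - + 4 * n) - (t * (1ℤ * 1ℤ * d) - (+ 4 * n * 1ℤ - + 4 * n))) - + 3 * t * (d - m) ≡
              + 3 * (t * m) - + 4 * n
      heavy = solve-∀
      sq : ∀ t n F e → (t * e - (+ 4 * n * F - n * (+ 4 * n))) ≡ (t * e - F * F) + (F - + 2 * n) * (F - + 2 * n)
      sq = solve-∀
    local : ∀ x (p : τ v x ≡ c v x ⊎ τ v x ≡ + m) →
      + 3 * + t * Z v x ≤ (+ 4 * (+ t * c v x) - + 4 * + n) - cost (wt {x} p) (c v x)
    local x (inj₁ p) = ≤-reflexive (trans (cong (+ 3 * + t *_) (trans (Z≡c-τ v x) (cong (_-_ (c v x)) p)))
                         (sym (light (+ t) (+ n) (c v x))))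
    local x (inj₂ p) = ≤-trans (≤-reflexive (cong (+ 3 * + t *_) (trans (Z≡c-τ v x) (cong (_-_ (c v x)) p))))
                         (by-gap (gap m-large) (heavy (+ t) (+ n) (c v x) (+ m)))
    ms : ∑ f * ∑ f ≤ + t * (∑[ x ] f x * f x * c v x)
    ms = ≤-trans (G.motzkin-straus v t f (λ x → wt≥0 {x} _) (λ xs l i _ → none v xs l i))
           (*-monoˡ {+ t} 0≤+n (GraphCount.energy-upper (N v) (N-sym₂ v) f))
    lower : 0ℤ ≤ (∑[ x ] cost (f x) (c v x))
    lower = subst (0ℤ ≤_) (sym (trans (∑-- _ _) (trans (cong₂ _-_ (∑-* _ _) (trans (∑-- _ _) (cong₂ _-_ (∑-* _ _) (∑-const _))))
              (sq (+ t) (+ n) (∑ f) _)))) (0≤+ (gap ms) (0≤sq _))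

  excess-bound : + 3 * (+ t * Ztot) ≤ + 4 * Δ
  excess-bound = subst₂ _≤_ (trans (∑-* _ _) (*-assoc _ _ _))
    (trans (∑-cong λ v → trans (∑-- _ _) (cong₂ _-_ (trans (∑-* _ _) (cong (+ 4 *_) (∑-* _ _))) (∑-const _)))
      (trans (∑-- _ _) (trans (cong₂ _-_ (trans (∑-* _ _) (cong (+ 4 *_) (∑-* _ _))) (∑-const _)) (i (+ t) (+ n) E))))
    (∑-mono link-excess)
    where
    opaque
      unfolding _+_
      i : ∀ t n e → + 4 * (t * e) - n * (n * (+ 4 * n)) ≡ + 4 * (t * e - n * (n * n))
      i = solve-∀

  -- Indicates that u is on the truncated line of x and y. `θ` is not symmetric in its last two
  -- arguments: cutting N(x, y) may lose u while cutting N(x, u) keeps y. With both factors, u for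
  -- given x, y as well as y for given x, u has at most m choices.
  f : Fin n → Fin n → Fin n → ℤ
  f x y u = θ x y u * θ x u y

  g : Fin n → Fin n → ℤ
  g x y = ∑[ u ] f x y u

  f-nonneg : ∀ x y u → 0ℤ ≤ f x y u
  f-nonneg x y u = 0≤* 0≤⟦ T x y u ⟧ 0≤⟦ T x u y ⟧

  W : Fin n → Fin n → ℤ
  W x y = + n - c x y

  W-nonneg : ∀ x y → 0ℤ ≤ W x y
  W-nonneg x y = gap (≤-trans (∑-mono λ z → ⟦ N x y z ⟧≤1) (≤-reflexive (trans (∑-const 1ℤ) (*1 _))))

  -- `W x y` counts the vertices off the line of x and y; `R` is its total, and `G₁`, `G₂` are the
  -- first and second moments of the line sizes `g` under this weight. `L` counts the five-vertex
  -- configurations.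
  L G₁ G₂ R : ℤ
  L = ∑[ x ] ∑[ y ] ∑[ v ] (1ℤ - ν x y v) * G.energy v (f x y)
  G₁ = ∑[ x ] ∑[ y ] W x y * g x y
  G₂ = ∑[ x ] ∑[ y ] W x y * (g x y * g x y)
  R = + n * (+ n * + n) - E

  G₁²≤RG₂ : G₁ * G₁ ≤ R * G₂
  G₁²≤RG₂ = subst (λ r → G₁ * G₁ ≤ r * G₂)
      (trans (∑-cong λ x → trans (∑-- _ _) (cong (_- (∑[ y ] c x y)) (∑-const _))) (trans (∑-- _ _) (cong (_- E) (∑-const _))))
    (PosLinear.cauchy-schwarz (∘-posLinear (∑-posLinear {n}) (∑-posLinear {n})) {w = λ (x , y) → W x y} (λ (x , y) → g x y) (λ (x , y) → W-nonneg x y))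

  -- Motzkin-Straus in the link of each v off the line, with the points of the line as weights: at
  -- least 1/t of the ordered pairs on the line form a triple with v.
  G₂≤tL : G₂ ≤ + t * L
  G₂≤tL = ≤-trans (∑-mono λ x → ∑-mono λ y → local x y)
      (≤-reflexive (trans (∑-cong λ x → ∑-* _ _) (∑-* _ _)))
    where
    opaque
      unfolding _+_
      i : ∀ p t e → p * (t * e) ≡ t * (p * e)
      i = solve-∀
    local : ∀ x y → W x y * (g x y * g x y) ≤ + t * (∑[ v ] (1ℤ - ν x y v) * G.energy v (f x y))
    local x y = subst₂ _≤_
      (trans (∑-*ʳ _ _) (cong (_* (g x y * g x y)) (trans (∑-- _ _) (cong (_- c x y) (trans (∑-const 1ℤ) (*1 _))))))
      (∑-* _ _)
      (∑-mono λ v → ≤-trans (*-monoˡ 0≤1-⟦ N x y v ⟧ (G.motzkin-straus v t (f x y) (f-nonneg x y) (λ xs l i _ → none v xs l i)))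
        (≤-reflexive (i (1ℤ - ν x y v) (+ t) _)))

  -- Here truncation pays: a vertex that occurs only in one truncated factor costs m instead of n.
  -- In `case₂` this vertex is b, in `case₃` it is w.
  ∑-θ : ∀ x y k → 0ℤ ≤ k → (∑[ z ] k * θ x y z) ≤ + m * k
  ∑-θ x y k k≥0 = ≤-trans (≤-reflexive (∑-* _ _)) (≤-trans (*-monoˡ k≥0 (τ≤m x y)) (≤-reflexive (*-comm _ _)))

  -- a, b, v, u, w : if u and w lie on the "line" of a and b while v does not, yet vuw is a triple, then one of the three 4-tuples is a cherry.
  five-point : ∀ a b v u w → (1ℤ - ν a b v) * (f a b u * (ν v u w * f a b w)) ≤
    f a b u * (f a b w * (1ℤ - ν a u w)) * ν u w v + cherry u a v w * θ a u b + cherry a b v u * θ a b w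
  five-point a b v u w
    rewrite ν₁ v u w | ν₂ u w v | ν₁ a u w | ν₂ a v u | ν₁ a u v =
    boole (T a b u) (T a u b) (T a b w) (T a w b) (N u v w) (N a b v) (N u a w) (N u a v) (N a b u) (truncate-⊆ m (N a b) u)
    where
    rhs-nonneg : ∀ p p' q q' X Y α γ o → 0ℤ ≤
      (⟦ p ⟧ * ⟦ p' ⟧) * ((⟦ q ⟧ * ⟦ q' ⟧) * (1ℤ - ⟦ α ⟧)) * ⟦ X ⟧ + (⟦ X ⟧ * (⟦ α ⟧ * (1ℤ - ⟦ γ ⟧))) * ⟦ p' ⟧
        + (⟦ γ ⟧ * (⟦ o ⟧ * (1ℤ - ⟦ Y ⟧))) * ⟦ q ⟧
    rhs-nonneg p p' q q' X Y α γ o = 0≤+ (0≤+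
      (0≤* (0≤* (0≤* 0≤⟦ p ⟧ 0≤⟦ p' ⟧) (0≤* (0≤* 0≤⟦ q ⟧ 0≤⟦ q' ⟧) 0≤1-⟦ α ⟧)) 0≤⟦ X ⟧)
      (0≤* (0≤* 0≤⟦ X ⟧ (0≤* 0≤⟦ α ⟧ 0≤1-⟦ γ ⟧)) 0≤⟦ p' ⟧))
      (0≤* (0≤* 0≤⟦ γ ⟧ (0≤* 0≤⟦ o ⟧ 0≤1-⟦ Y ⟧)) 0≤⟦ q ⟧)
    opaque
      unfolding _+_
      boole : ∀ p p' q q' X Y α γ o → (p ≡ true → o ≡ true) →
        (1ℤ - ⟦ Y ⟧) * ((⟦ p ⟧ * ⟦ p' ⟧) * (⟦ X ⟧ * (⟦ q ⟧ * ⟦ q' ⟧))) ≤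
        (⟦ p ⟧ * ⟦ p' ⟧) * ((⟦ q ⟧ * ⟦ q' ⟧) * (1ℤ - ⟦ α ⟧)) * ⟦ X ⟧ + (⟦ X ⟧ * (⟦ α ⟧ * (1ℤ - ⟦ γ ⟧))) * ⟦ p' ⟧
          + (⟦ γ ⟧ * (⟦ o ⟧ * (1ℤ - ⟦ Y ⟧))) * ⟦ q ⟧
      boole p p' q q' X true α γ o h = rhs-nonneg p p' q q' X true α γ o
      boole false p' q q' X false α γ o h = rhs-nonneg false p' q q' X false α γ o
      boole true false q q' X false α γ o h = rhs-nonneg true false q q' X false α γ o
      boole true true q q' false false α γ o h = rhs-nonneg true true q q' false false α γ o
      boole true true false q' true false α γ o h = rhs-nonneg true true false q' true false α γ o
      boole true true true false true false α γ o h = rhs-nonneg true true true false true false α γ o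
      -- Only here is the left side 1. If auw (`α`) is missing, the first term is 1; if it is
      -- present but auv (`γ`) is missing, u is the apex of a cherry; if auv is present, then auv
      -- and abu without abv form a cherry with apex a.
      boole true true true true true false α γ o h with o | h refl
      boole true true true true true false false false o h | .true | refl = ≤-refl
      boole true true true true true false false true  o h | .true | refl = +≤+ (s≤s z≤n)
      boole true true true true true false true  false o h | .true | refl = ≤-refl
      boole true true true true true false true  true  o h | .true | refl = ≤-refl

  L-expand : L ≡ (∑[ a ] ∑[ b ] ∑[ v ] ∑[ u ] ∑[ w ] (1ℤ - ν a b v) * (f a b u * (ν v u w * f a b w)))
  L-expand = ∑-cong λ a → ∑-cong λ b → ∑-cong λ v → trans (sym (∑-* _ _)) (∑-cong λ u →
    trans (cong ((1ℤ - ν a b v) *_) (sym (∑-* _ _))) (sym (∑-* _ _)))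

  -- The fifth vertex v is confined only by `ν u w v`, which is not truncated. Its codegree is split
  -- into `τ u w`, at most m and paired with the cherry (a; u, w, b), and the excess `Z u w`, paired
  -- with `θ a u b`, whose sum over b is at most m.
  case₁ : (∑[ a ] ∑[ b ] ∑[ v ] ∑[ u ] ∑[ w ] f a b u * (f a b w * (1ℤ - ν a u w)) * ν u w v) ≤ + m * B + + n * (+ m * Ztot)
  case₁ = ≤-trans (≤-reflexive reorder) (≤-trans (∑-mono λ a → ∑-mono λ u → ∑-mono λ w → ∑-mono λ b → local a u w b)
      (≤-trans (≤-reflexive split) (+-mono-≤ ≤-refl (≤-trans (∑-mono λ a → ∑-mono λ u → ∑-mono λ w → ∑-θ a u (Z u w) (Z-nonneg u w))
        (≤-reflexive (trans (∑-cong λ a → trans (∑-cong λ u → ∑-* _ _) (∑-* _ _)) (∑-const _)))))))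
    where
    h : Fin n → Fin n → Fin n → Fin n → ℤ
    h a u w b = f a b u * (f a b w * (1ℤ - ν a u w))
    reorder : (∑[ a ] ∑[ b ] ∑[ v ] ∑[ u ] ∑[ w ] h a u w b * ν u w v) ≡ (∑[ a ] ∑[ u ] ∑[ w ] ∑[ b ] h a u w b * c u w)
    reorder = ∑-cong λ a → trans (∑-cong λ b → trans (∑-comm _) (∑-cong λ u → trans (∑-comm _) (∑-cong λ w → ∑-* _ _)))
      (trans (∑-comm _) (∑-cong λ u → ∑-comm _))
    split : (∑[ a ] ∑[ u ] ∑[ w ] ∑[ b ] (+ m * cherry a u w b + Z u w * θ a u b)) ≡
      + m * B + (∑[ a ] ∑[ u ] ∑[ w ] ∑[ b ] Z u w * θ a u b)
    split = trans (∑-cong λ a → trans (∑-cong λ u → trans (∑-cong λ w → trans (∑-+ _ _) (cong₂ _+_ (∑-* _ _) refl))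
      (trans (∑-+ _ _) (cong₂ _+_ (∑-* _ _) refl))) (trans (∑-+ _ _) (cong₂ _+_ (∑-* _ _) refl))) (trans (∑-+ _ _) (cong₂ _+_ (∑-* _ _) refl))
    h≤cherry : ∀ a u w b → h a u w b ≤ cherry a u w b
    h≤cherry a u w b rewrite ν₂ a w b | ν₂ a u b =
      boole (T a b u) (T a u b) (T a b w) (T a w b) (N a u w) (N a b u) (N a b w) (truncate-⊆ m (N a b) u) (truncate-⊆ m (N a b) w)
      where
      opaque
        unfolding _+_
        boole : ∀ p p' q q' α o o' → (p ≡ true → o ≡ true) → (q ≡ true → o' ≡ true) →
          (⟦ p ⟧ * ⟦ p' ⟧) * ((⟦ q ⟧ * ⟦ q' ⟧) * (1ℤ - ⟦ α ⟧)) ≤ ⟦ o' ⟧ * (⟦ o ⟧ * (1ℤ - ⟦ α ⟧))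
        boole false p' q q' α o o' h k = 0≤* 0≤⟦ o' ⟧ (0≤* 0≤⟦ o ⟧ 0≤1-⟦ α ⟧)
        boole true false q q' α o o' h k = 0≤* 0≤⟦ o' ⟧ (0≤* 0≤⟦ o ⟧ 0≤1-⟦ α ⟧)
        boole true true false q' α o o' h k = 0≤* 0≤⟦ o' ⟧ (0≤* 0≤⟦ o ⟧ 0≤1-⟦ α ⟧)
        boole true true true false α o o' h k = 0≤* 0≤⟦ o' ⟧ (0≤* 0≤⟦ o ⟧ 0≤1-⟦ α ⟧)
        boole true true true true α o o' h k rewrite h refl | k refl = ≤-refl
    h≤θ : ∀ a u w b → h a u w b ≤ θ a u b
    h≤θ a u w b = boole (T a b u) (T a u b) (T a b w) (T a w b) (N a u w)
      where
      opaque
        unfolding _+_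
        boole : ∀ p p' q q' α → (⟦ p ⟧ * ⟦ p' ⟧) * ((⟦ q ⟧ * ⟦ q' ⟧) * (1ℤ - ⟦ α ⟧)) ≤ ⟦ p' ⟧
        boole false p' q q' α = 0≤⟦ p' ⟧
        boole true false q q' α = ≤-refl
        boole true true false q' α = 0≤+n
        boole true true true false α = 0≤+n
        boole true true true true false = ≤-refl
        boole true true true true true = 0≤+n
    opaque
      unfolding _+_
      i : ∀ m k z θ c τ h → (m * k + z * θ) - h * c ≡ (m - τ) * k + (τ * (k - h) + z * (θ - h)) + h * ((z + τ) - c)
      i = solve-∀
      j : ∀ h c τ → h * ((c - τ + τ) - c) ≡ 0ℤ
      j = solve-∀
    τ-nonneg : ∀ x y → 0ℤ ≤ τ x y
    τ-nonneg x y = ∑-nonneg λ z → 0≤⟦ T x y z ⟧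
    local : ∀ a u w b → h a u w b * c u w ≤ + m * cherry a u w b + Z u w * θ a u b
    local a u w b = by-gap (0≤+ (0≤+ (0≤* (gap (τ≤m u w)) (cherry-nonneg a u w b))
        (0≤+ (0≤* (τ-nonneg u w) (gap (h≤cherry a u w b))) (0≤* (Z-nonneg u w) (gap (h≤θ a u w b)))))
        (≤-reflexive (sym (trans (cong (λ z → h a u w b * (z + τ u w - c u w)) (Z≡c-τ u w)) (j _ _ _)))))
      (i (+ m) (cherry a u w b) (Z u w) (θ a u b) (c u w) (τ u w) (h a u w b))

  case₂ : (∑[ a ] ∑[ b ] ∑[ v ] ∑[ u ] ∑[ w ] cherry u a v w * θ a u b) ≤ + m * B
  case₂ = ≤-trans (≤-reflexive reorder)
      (≤-trans (∑-mono λ u → ∑-mono λ a → ∑-mono λ v → ∑-mono λ w → ∑-θ a u _ (cherry-nonneg u a v w))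
      (≤-reflexive (trans (∑-cong λ u → trans (∑-cong λ a → trans (∑-cong λ v → ∑-* _ _) (∑-* _ _)) (∑-* _ _)) (∑-* _ _))))
    where
    reorder : (∑[ a ] ∑[ b ] ∑[ v ] ∑[ u ] ∑[ w ] cherry u a v w * θ a u b) ≡ (∑[ u ] ∑[ a ] ∑[ v ] ∑[ w ] ∑[ b ] cherry u a v w * θ a u b)
    reorder = trans (∑-cong λ a → trans (∑-cong λ b → ∑-comm _) (trans (∑-comm _) (∑-cong λ u → trans (∑-comm _) (∑-cong λ v → ∑-comm _)))) (∑-comm _)

  case₃ : (∑[ a ] ∑[ b ] ∑[ v ] ∑[ u ] ∑[ w ] cherry a b v u * θ a b w) ≤ + m * B
  case₃ = ≤-trans (∑-mono λ a → ∑-mono λ b → ∑-mono λ v → ∑-mono λ u → ∑-θ a b _ (cherry-nonneg a b v u))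
    (≤-reflexive (trans (∑-cong λ u → trans (∑-cong λ a → trans (∑-cong λ v → ∑-* _ _) (∑-* _ _)) (∑-* _ _)) (∑-* _ _)))

  L≤ : L ≤ + m * B + + n * (+ m * Ztot) + + m * B + + m * B
  L≤ = ≤-trans (≤-reflexive L-expand) (≤-trans
    (∑-mono λ a → ∑-mono λ b → ∑-mono λ v → ∑-mono λ u → ∑-mono λ w → five-point a b v u w)
    (≤-trans (≤-reflexive (trans (Λ-+ _ _) (cong₂ _+_ (Λ-+ _ _) refl))) (+-mono-≤ (+-mono-≤ case₁ case₂) case₃)))
    where
    Σp : PosLinear (∑ {n})
    Σp = ∑-posLinear
    open PosLinear (∘-posLinear Σp (∘-posLinear Σp (∘-posLinear Σp (∘-posLinear Σp Σp))))

  -- The two truncations lose at most Z + Z' points of the full line, so g ≥ c - Z - Z', and these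
  -- losses are weighted by W ≤ n. Exchanging b and u turns the sum of Z' into `Ztot`, which is why
  -- it is subtracted twice.
  G₁≥ : + n * E - Q - + n * Ztot - + n * Ztot ≤ G₁
  G₁≥ = subst (_≤ G₁) eq (∑-mono λ a → ∑-mono λ b → local a b)
    where
    Z' : Fin n → Fin n → ℤ
    Z' a b = ∑[ u ] (ν a u b - θ a u b)
    Z'-nonneg : ∀ a b → 0ℤ ≤ Z' a b
    Z'-nonneg a b = ∑-nonneg λ u → θ≤ν a u b
    g≥ : ∀ a b → c a b - Z a b - Z' a b ≤ g a b
    g≥ a b = ≤-trans (≤-reflexive (sym (trans (∑-- _ _) (cong₂ _-_ (∑-- _ _) refl)))) (∑-mono λ u → pt u)
      where
      opaque
        unfolding _+_
        boole : ∀ p q o → (p ≡ true → o ≡ true) → (q ≡ true → o ≡ true) → ⟦ o ⟧ - (⟦ o ⟧ - ⟦ p ⟧) - (⟦ o ⟧ - ⟦ q ⟧) ≤ ⟦ p ⟧ * ⟦ q ⟧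
        boole true true o h k rewrite h refl = ≤-refl
        boole true false o h k rewrite h refl = ≤-refl
        boole false true o h k rewrite k refl = ≤-refl
        boole false false true h k = ℤ.-≤+
        boole false false false h k = ≤-refl
      pt : ∀ u → ν a b u - (ν a b u - θ a b u) - (ν a u b - θ a u b) ≤ f a b u
      pt u rewrite ν₂ a u b = boole (T a b u) (T a u b) (N a b u) (truncate-⊆ m (N a b) u)
        (λ e → trans (N-sym₂ a b u) (truncate-⊆ m (N a u) b e))
    opaque
      unfolding _+_
      i : ∀ n c z z' g → (n - c) * g - (n * c - c * c - n * z - n * z') ≡ (n - c) * (g - (c - z - z')) + c * (z + z')
      i = solve-∀
    local : ∀ a b → + n * c a b - c a b * c a b - + n * Z a b - + n * Z' a b ≤ W a b * g a b
    local a b = by-gap (0≤+ (0≤* (W-nonneg a b) (gap (g≥ a b))) (0≤* (c-nonneg a b) (0≤+ (Z-nonneg a b) (Z'-nonneg a b))))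
      (i (+ n) (c a b) (Z a b) (Z' a b) (g a b))
    Σp : PosLinear (∑ {n})
    Σp = ∑-posLinear
    open PosLinear (∘-posLinear Σp Σp)
    eq : (∑[ a ] ∑[ b ] (+ n * c a b - c a b * c a b - + n * Z a b - + n * Z' a b)) ≡ + n * E - Q - + n * Ztot - + n * Ztot
    eq = trans (Λ-- _ _) (cong₂ _-_ (trans (Λ-- _ _) (cong₂ _-_ (trans (Λ-- _ _) (cong₂ _-_ (Λ-* _ _) refl)) (Λ-* _ _)))
      (trans (Λ-* _ _) (cong (+ n *_) (∑-cong λ a → ∑-comm _))))

-- From the counting inequalities to the density of N

0<+suc : ∀ {n} → 0ℤ < +[1+ n ]
0<+suc = +<+ (s≤s z≤n)

opaque
  unfolding _+_

  0<* : ∀ {a b} → 0ℤ < a → 0ℤ < b → 0ℤ < a * b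
  0<* {+[1+ a ]} {+[1+ b ]} _ _ = 0<+suc
  0<* {+ 0} (+<+ ())
  0<* {+[1+ _ ]} {+ 0} _ (+<+ ())

  0<+ : ∀ {a b} → 0ℤ < a → 0ℤ ≤ b → 0ℤ < a + b
  0<+ = ℤₚ.+-mono-<-≤

0<-cancelˡ : ∀ {c a} → 0ℤ ≤ c → 0ℤ < c * a → 0ℤ < a
0<-cancelˡ {c} {a} c≥0 p with 0ℤ <? a
... | yes q = q
... | no q  = ⊥-elim (<-irrefl refl (ℤₚ.<-≤-trans p (≤-trans (*-monoˡ c≥0 (≮⇒≥ q)) (≤-reflexive (*-zeroʳ c)))))

0≤-cancelˡ : ∀ {c a} → 0ℤ < c → 0ℤ ≤ c * a → 0ℤ ≤ a
0≤-cancelˡ {c} {a} c>0 p = *-cancelˡ c>0 (subst (_≤ c * a) (sym (*-zeroʳ c)) p)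

un-gap : ∀ {a b} → 0ℤ ≤ b - a → a ≤ b
un-gap p = by-gap p refl

by : ∀ {a d} → 0ℤ ≤ d → a ≡ d → 0ℤ ≤ a
by p q = subst (0ℤ ≤_) (sym q) p

-- Three times the link bound added to the four-point bound cancels B; with E² ≤ n² Q there remains
-- (n³ - E)(3E - 2n³) ≥ 0. So N has density at least 2/3, more than is required. For r = 3 the daisy
-- is three triples on four vertices, and this is the classical bound 1/3.
arithmetic₂ : ∀ n E Q B → 0ℤ ≤ n → 0ℤ ≤ E → E ≤ n * (n * n) → E * E ≤ n * n * Q →
  0ℤ ≤ n * (n * (n * n)) - + 4 * (n * E) + + 3 * Q + + 3 * B →
  (1ℤ + + 1) * Q + n * (n * (n * n)) + + 1 * B ≤ (+ 2 + + 1) * (n * E) →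
  n * (n * n) ≤ + 12 * (+ 2 * (+ 2 * E - n * (n * n)))
arithmetic₂ n E Q B n≥0 E≥0 E≤n³ cs four link with E ≟ n * (n * n)
... | yes eq = by-gap (0≤* {+ 23} 0≤+n E≥0) (trans (cong (λ q → + 12 * (+ 2 * (+ 2 * E - q)) - q) (sym eq)) (i E))
  where
  opaque
    unfolding _+_
    i : ∀ E → + 12 * (+ 2 * (+ 2 * E - E)) - E ≡ + 23 * E
    i = solve-∀
... | no neq = by-gap (0≤+ (0≤* {+ 16} 0≤+n 3E≥2n³) (0≤* {+ 7} 0≤+n (0≤* n≥0 (0≤* n≥0 n≥0)))) (j n E)
  where
  opaque
    unfolding _+_
    j : ∀ n E → + 12 * (+ 2 * (+ 2 * E - n * (n * n))) - n * (n * n) ≡ + 16 * (+ 3 * E - + 2 * (n * (n * n))) + + 7 * (n * (n * n))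
    j = solve-∀
    k : ∀ n E Q B → (n * (n * n) - E) * (+ 3 * E - + 2 * (n * (n * n))) ≡
      n * n * ((n * (n * (n * n)) - + 4 * (n * E) + + 3 * Q + + 3 * B)
        + + 3 * ((+ 2 + + 1) * (n * E) - ((1ℤ + + 1) * Q + n * (n * (n * n)) + + 1 * B))) + + 3 * (n * n * Q - E * E)
    k = solve-∀
  3E≥2n³ : 0ℤ ≤ + 3 * E - + 2 * (n * (n * n))
  3E≥2n³ = 0≤-cancelˡ (≤∧≢⇒< (gap E≤n³) λ q → neq (sym (-‿injective (sym q))))
    (by (0≤+ (0≤* (0≤* n≥0 n≥0) (0≤+ four (0≤* {+ 3} 0≤+n (gap link)))) (0≤* {+ 3} 0≤+n (gap cs))) (k n E Q B))

-- Writing t = 3 + s makes every remaining polynomial in s have nonnegative coefficients; this is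
-- how t ≥ 3 is used.
module Arithmetic₃ (n s E Q B Z L G₁ G₂ m : ℤ) (n>0 : 0ℤ < n) (s≥0 : 0ℤ ≤ s) (m≥0 : 0ℤ ≤ m) (B≥0 : 0ℤ ≤ B) (Z≥0 : 0ℤ ≤ Z) where
  k t n³ Δ R : ℤ
  k = + 2 + s
  t = 1ℤ + k
  n³ = n * (n * n)
  Δ = t * E - n³
  R = n³ - E

  n≥0 = ℤₚ.<⇒≤ n>0

  k>0 : 0ℤ < k
  k>0 = 0<+ {+ 2} 0<+suc s≥0

  k≥0 = ℤₚ.<⇒≤ k>0

  t>0 : 0ℤ < t
  t>0 = 0<+ {1ℤ} 0<+suc k≥0

  t≥0 = ℤₚ.<⇒≤ t>0

  result : E ≤ n³ → E * E ≤ n * n * Q →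
    (1ℤ + k) * Q + n * n³ + k * B ≤ (+ 2 + k) * (n * E) →
    + 3 * (t * Z) ≤ + 4 * Δ →
    + 5 * (t * m) ≤ + 7 * n →
    G₁ * G₁ ≤ R * G₂ → G₂ ≤ t * L → L ≤ m * B + n * (m * Z) + m * B + m * B →
    n * E - Q - n * Z - n * Z ≤ G₁ →
    n³ ≤ + 12 * (t * Δ)
  result E≤n³ cs link excess m-small G₁² G₂≤ L≤ G₁≥ with n³ ≤? + 12 * (t * Δ)
  ... | yes p = p
  -- Assuming that the goal fails gives X ≥ 0, so that the lower bound X ≤ Y for G₁ can be squared,
  -- and R > 0, so that R can be cancelled.
  ... | no p  = un-gap (0≤-cancelˡ (0<* {+ 45} 0<+suc k>0) (by (0≤+ (0≤* t≥0 final) (0≤* Δ≥0 poly₂)) (id-g n s E)))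
    where
    opaque
      unfolding _+_
      -- Yields t * B ≤ n * Δ, the bound of the cherries by the excess: what the link bound and
      -- Cauchy-Schwarz leave over is the square of Δ.
      id-b : ∀ n s E Q B → let k = + 2 + s ; t = 1ℤ + k ; n³ = n * (n * n) ; Δ = t * E - n³ in
        k * (n * n) * (n * Δ - t * B) ≡
        t * (n * n * ((+ 2 + k) * (n * E) - ((1ℤ + k) * Q + n * n³ + k * B)) + t * (n * n * Q - E * E)) + Δ * Δ
      id-b = solve-∀
      -- 13 = 9 + 4: three cherry terms with 3t * B ≤ 3n * Δ each, and the truncated excess with 3t
      -- * Z ≤ 4 * Δ.
      id-c : ∀ n t Δ B Z L m → + 13 * (m * (n * Δ)) - + 3 * (t * L) ≡
        + 3 * (t * (m * B + n * (m * Z) + m * B + m * B - L)) + + 9 * (m * (n * Δ - t * B)) + n * (m * (+ 4 * Δ - + 3 * (t * Z)))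
      id-c = solve-∀
      id-d : ∀ n s E Q B Z G₁ → let k = + 2 + s ; t = 1ℤ + k ; n³ = n * (n * n) ; Δ = t * E - n³ ; R = n³ - E in
        + 3 * (t * G₁) - n * (+ 3 * R - + 8 * Δ) ≡
        + 3 * (t * (G₁ - (n * E - Q - n * Z - n * Z))) + + 3 * (((+ 2 + k) * (n * E) - ((1ℤ + k) * Q + n * n³ + k * B)) + k * B)
          + + 2 * (n * (+ 4 * Δ - + 3 * (t * Z)))
      id-d = solve-∀
      id-e : ∀ n s E → let k = + 2 + s ; t = 1ℤ + k ; n³ = n * (n * n) ; Δ = t * E - n³ ; R = n³ - E in
        t * (+ 3 * R - + 8 * Δ) ≡ + 3 * (k * (n³ - + 12 * (t * Δ))) + Δ * (+ 36 * (s * s) + + 172 * s + + 189)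
      id-e = solve-∀
      id-f : ∀ X Y → Y * Y - X * X ≡ (Y - X) * (Y + X)
      id-f = solve-∀
      id-R : ∀ n s E → let k = + 2 + s ; t = 1ℤ + k ; n³ = n * (n * n) ; Δ = t * E - n³ ; R = n³ - E in
        + 12 * t * (t * R) ≡ (+ 71 + (+ 12 * (s * s) + + 60 * s)) * n³ + (n³ - + 12 * (t * Δ))
      id-R = solve-∀
      -- The chain 45t²G₁² ≤ 45t²R G₂ ≤ 45t³R L ≤ 195t²R m nΔ ≤ 273t R n²Δ, where 195 = 15 * 13 and
      -- 273 = 39 * 7 by 5t * m ≤ 7n, against 45t²G₁² = 5Y² ≥ 5X² = n²(45R² - 240RΔ + 320Δ²).
      id-h : ∀ n t Δ R L G₁ G₂ m → n * n * (R * ((+ 273 * t + + 240) * Δ - + 45 * R)) ≡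
        + 39 * (t * (R * (n * (Δ * (+ 7 * n - + 5 * (t * m)))))) + + 15 * (t * (t * (R * (+ 13 * (m * (n * Δ)) - + 3 * (t * L)))))
        + + 45 * (t * (t * (R * (t * L - G₂)))) + + 45 * (t * (t * (R * G₂ - G₁ * G₁)))
        + + 5 * ((+ 3 * (t * G₁)) * (+ 3 * (t * G₁)) - (n * (+ 3 * R - + 8 * Δ)) * (n * (+ 3 * R - + 8 * Δ)))
        + + 320 * (n * n * (Δ * Δ))
      id-h = solve-∀
      -- Rests on t * R = (t - 1) * n³ - Δ. At s = 0 the remainder is only 18 * Δ.
      id-g : ∀ n s E → let k = + 2 + s ; t = 1ℤ + k ; n³ = n * (n * n) ; Δ = t * E - n³ ; R = n³ - E in
        + 45 * k * (+ 12 * (t * Δ) - n³) ≡ t * ((+ 273 * t + + 240) * Δ - + 45 * R) + Δ * (+ 267 * (s * s) + + 822 * s + + 18)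
      id-g = solve-∀
    H : 0ℤ < n³ - + 12 * (t * Δ)
    H = ≤∧≢⇒< (gap (ℤₚ.<⇒≤ (ℤₚ.≰⇒> p))) λ q → p (≤-reflexive (-‿injective (sym q)))
    H≥0 = ℤₚ.<⇒≤ H
    n³≥0 : 0ℤ ≤ n³
    n³≥0 = 0≤* n≥0 (0≤* n≥0 n≥0)
    R≥0 = gap E≤n³
    Δ≥0 : 0ℤ ≤ Δ
    Δ≥0 = 0≤-cancelˡ {+ 4} 0<+suc (≤-trans (0≤* {+ 3} 0≤+n (0≤* t≥0 Z≥0)) excess)
    poly₀ : 0ℤ ≤ + 36 * (s * s) + + 172 * s + + 189
    poly₀ = 0≤+ (0≤+ (0≤* {+ 36} 0≤+n (0≤sq s)) (0≤* {+ 172} 0≤+n s≥0)) 0≤+n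
    poly₂ : 0ℤ ≤ + 267 * (s * s) + + 822 * s + + 18
    poly₂ = 0≤+ (0≤+ (0≤* {+ 267} 0≤+n (0≤sq s)) (0≤* {+ 822} 0≤+n s≥0)) 0≤+n
    n²>0 : 0ℤ < n * n
    n²>0 = 0<* n>0 n>0
    tB≤nΔ : 0ℤ ≤ n * Δ - t * B
    tB≤nΔ = 0≤-cancelˡ (0<* k>0 n²>0) (by (0≤+ (0≤* t≥0 (0≤+ (0≤* (ℤₚ.<⇒≤ n²>0) (gap link)) (0≤* t≥0 (gap cs)))) (0≤sq Δ))
      (id-b n s E Q B))
    L-small : 0ℤ ≤ + 13 * (m * (n * Δ)) - + 3 * (t * L)
    L-small = by (0≤+ (0≤+ (0≤* {+ 3} 0≤+n (0≤* t≥0 (gap L≤))) (0≤* {+ 9} 0≤+n (0≤* m≥0 tB≤nΔ))) (0≤* n≥0 (0≤* m≥0 (gap excess))))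
      (id-c n t Δ B Z L m)
    X Y : ℤ
    X = n * (+ 3 * R - + 8 * Δ)
    Y = + 3 * (t * G₁)
    X≤Y : 0ℤ ≤ Y - X
    X≤Y = by (0≤+ (0≤+ (0≤* {+ 3} 0≤+n (0≤* t≥0 (gap G₁≥))) (0≤* {+ 3} 0≤+n (0≤+ (gap link) (0≤* k≥0 B≥0))))
      (0≤* {+ 2} 0≤+n (0≤* n≥0 (gap excess)))) (id-d n s E Q B Z G₁)
    X≥0 : 0ℤ ≤ X
    X≥0 = 0≤* n≥0 (0≤-cancelˡ t>0 (by (0≤+ (0≤* {+ 3} 0≤+n (0≤* k≥0 H≥0)) (0≤* Δ≥0 poly₀)) (id-e n s E)))
    X²≤Y² : 0ℤ ≤ Y * Y - X * X
    X²≤Y² = by (0≤* X≤Y (0≤+ (≤-trans X≥0 (un-gap X≤Y)) X≥0)) (id-f X Y)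
    R>0 : 0ℤ < R
    R>0 = 0<-cancelˡ t≥0 (0<-cancelˡ {+ 12 * t} (0≤* {+ 12} 0≤+n t≥0) (subst (0ℤ <_) (sym (id-R n s E))
      (ℤₚ.<-≤-trans H (by-gap {d = (+ 71 + (+ 12 * (s * s) + + 60 * s)) * n³}
        (0≤* (0≤+ {+ 71} 0≤+n (0≤+ (0≤* {+ 12} 0≤+n (0≤sq s)) (0≤* {+ 60} 0≤+n s≥0))) n³≥0) (cancel _ _)))))
      where
      opaque
        unfolding _+_
        cancel : ∀ a b → a + b - b ≡ a
        cancel = solve-∀
    final : 0ℤ ≤ (+ 273 * t + + 240) * Δ - + 45 * R
    final = 0≤-cancelˡ R>0 (0≤-cancelˡ n²>0 (by
      (0≤+ (0≤+ (0≤+ (0≤+ (0≤+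
        (0≤* {+ 39} 0≤+n (0≤* t≥0 (0≤* R≥0 (0≤* n≥0 (0≤* Δ≥0 (gap m-small))))))
        (0≤* {+ 15} 0≤+n (0≤* t≥0 (0≤* t≥0 (0≤* R≥0 L-small)))))
        (0≤* {+ 45} 0≤+n (0≤* t≥0 (0≤* t≥0 (0≤* R≥0 (gap G₂≤))))))
        (0≤* {+ 45} 0≤+n (0≤* t≥0 (0≤* t≥0 (gap G₁²)))))
        (0≤* {+ 5} 0≤+n X²≤Y²))
        (0≤* {+ 320} 0≤+n (0≤* (ℤₚ.<⇒≤ n²>0) (0≤sq Δ))))
      (id-h n t Δ R L G₁ G₂ m)))

-- Rounding 4n/(3t) up by at most one makes t * m exceed 4n/3 by at most t ≤ n/15, and 4/3 + 1/15 =
-- 7/5.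
truncation-level : ∀ n t → 15 ℕ.* t ℕ.≤ n → 0 ℕ.< t → ∃ λ m → (4 ℕ.* n ℕ.≤ 3 ℕ.* (t ℕ.* m)) × (5 ℕ.* (t ℕ.* m) ℕ.≤ 7 ℕ.* n)
truncation-level n t@(suc t') big _ = suc q , lower , upper
  where
  q = (4 ℕ.* n) ℕ./ (3 ℕ.* t)
  r = (4 ℕ.* n) ℕ.% (3 ℕ.* t)
  div : 4 ℕ.* n ≡ r ℕ.+ q ℕ.* (3 ℕ.* t)
  div = ℕ.m≡m%n+[m/n]*n (4 ℕ.* n) (3 ℕ.* t)
  i : ∀ t q → 3 ℕ.* t ℕ.+ q ℕ.* (3 ℕ.* t) ≡ 3 ℕ.* (t ℕ.* (1 ℕ.+ q))
  i = solve-∀ℕ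
  j : ∀ t q → 3 ℕ.* (5 ℕ.* (t ℕ.* (1 ℕ.+ q))) ≡ 5 ℕ.* (q ℕ.* (3 ℕ.* t)) ℕ.+ 15 ℕ.* t
  j = solve-∀ℕ
  k : ∀ n → 5 ℕ.* (4 ℕ.* n) ℕ.+ n ≡ 3 ℕ.* (7 ℕ.* n)
  k = solve-∀ℕ
  open ℕₚ.≤-Reasoning
  lower : 4 ℕ.* n ℕ.≤ 3 ℕ.* (t ℕ.* suc q)
  lower = begin
    4 ℕ.* n                   ≡⟨ div ⟩
    r ℕ.+ q ℕ.* (3 ℕ.* t)     ≤⟨ ℕₚ.+-monoˡ-≤ _ (ℕₚ.<⇒≤ (ℕ.m%n<n (4 ℕ.* n) (3 ℕ.* t))) ⟩
    3 ℕ.* t ℕ.+ q ℕ.* (3 ℕ.* t) ≡⟨ i t q ⟩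
    3 ℕ.* (t ℕ.* suc q)       ∎
  upper : 5 ℕ.* (t ℕ.* suc q) ℕ.≤ 7 ℕ.* n
  upper = ℕₚ.*-cancelˡ-≤ 3 (begin
    3 ℕ.* (5 ℕ.* (t ℕ.* suc q))            ≡⟨ j t q ⟩
    5 ℕ.* (q ℕ.* (3 ℕ.* t)) ℕ.+ 15 ℕ.* t   ≤⟨ ℕₚ.+-mono-≤ (ℕₚ.*-monoʳ-≤ 5 (subst (q ℕ.* (3 ℕ.* t) ℕ.≤_) (sym div) (ℕₚ.m≤n+m _ r))) big ⟩
    5 ℕ.* (4 ℕ.* n) ℕ.+ n                  ≡⟨ k n ⟩
    3 ℕ.* (7 ℕ.* n)                        ∎)

3+s≡ : ∀ s → + (3 ℕ.+ s) ≡ 1ℤ + (+ 2 + + s)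
3+s≡ s = trans (pos-+ 1 (2 ℕ.+ s)) (cong (_+_ 1ℤ) (pos-+ 2 s))

triple-density₃ : ∀ {n} (N : Fin n → Fin n → Fin n → Bool) →
  (∀ x y z → N x y z ≡ N y x z) → (∀ x y z → N x y z ≡ N x z y) →
  ∀ s → 15 ℕ.* (3 ℕ.+ s) ℕ.≤ n →
  (∀ v xs → length xs ≡ suc (3 ℕ.+ s) → AllPairs (λ x y → N v x y ≡ false) xs → ⊥) →
  ∃ (λ m → (4 ℕ.* n ℕ.≤ 3 ℕ.* ((3 ℕ.+ s) ℕ.* m)) × (5 ℕ.* ((3 ℕ.+ s) ℕ.* m) ℕ.≤ 7 ℕ.* n)) →
  + n * (+ n * + n) ≤ + 12 * (+ (3 ℕ.+ s) * (+ (3 ℕ.+ s) * (∑[ x ] ∑[ y ] ∑[ z ] ⟦ N x y z ⟧) - + n * (+ n * + n)))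
triple-density₃ {n} N s₁ s₂ s big none (m , large , small) =
  subst (λ t → + n * (+ n * + n) ≤ + 12 * (t * (t * E - + n * (+ n * + n)))) (sym (3+s≡ s))
    (Arithmetic₃.result (+ n) (+ s) E Q B Ztot L G₁ G₂ (+ m)
      (+<+ (ℕₚ.<-≤-trans (s≤s z≤n) big)) 0≤+n 0≤+n B-nonneg Ztot-nonneg
      E≤n³ E²≤n²Q
      (subst (λ k → (1ℤ + k) * Q + + n * (+ n * (+ n * + n)) + k * B ≤ (+ 2 + k) * (+ n * E)) (pos-+ 2 s)
        (link-cherry-bound (2 ℕ.+ s) refl))
      (subst (λ t → + 3 * (t * Ztot) ≤ + 4 * (t * E - + n * (+ n * + n))) (3+s≡ s) excess-bound)
      (subst (λ t → + 5 * (t * + m) ≤ + 7 * + n) (3+s≡ s)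
        (subst₂ _≤_ (pos-*³ 5 (3 ℕ.+ s) m) (pos-* 7 n) (+≤+ small)))
      G₁²≤RG₂ (subst (λ t → G₂ ≤ t * L) (3+s≡ s) G₂≤tL) L≤ G₁≥)
  where
  open Triple N s₁ s₂ (3 ℕ.+ s) none
  open Truncated N s₁ s₂ (3 ℕ.+ s) none m (subst₂ _≤_ (pos-* 4 n) (pos-*³ 3 (3 ℕ.+ s) m) (+≤+ large))

triple-density : ∀ {n} (N : Fin n → Fin n → Fin n → Bool) →
  (∀ x y z → N x y z ≡ N y x z) → (∀ x y z → N x y z ≡ N x z y) →
  ∀ t → 2 ℕ.≤ t → 15 ℕ.* t ℕ.≤ n →
  (∀ v xs → length xs ≡ suc t → AllPairs (λ x y → N v x y ≡ false) xs → ⊥) →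
  + n * (+ n * + n) ≤ + 12 * (+ t * (+ t * (∑[ x ] ∑[ y ] ∑[ z ] ⟦ N x y z ⟧) - + n * (+ n * + n)))
triple-density N s₁ s₂ (suc zero) (s≤s ())
triple-density {n} N s₁ s₂ (suc (suc zero)) _ _ none = arithmetic₂ (+ n) E Q B 0≤+n
    (∑-nonneg λ x → ∑-nonneg λ y → c-nonneg x y) E≤n³ E²≤n²Q four-point (link-cherry-bound 1 refl)
  where open Triple N s₁ s₂ 2 none
triple-density {n} N s₁ s₂ (suc (suc (suc s))) _ big none =
  triple-density₃ N s₁ s₂ s big none (truncation-level n (3 ℕ.+ s) big (s≤s z≤n))

-- Vertex sets as ranges of tuples

private variable n k : ℕ

infix 4 _≟ₛ_ _∈?_

_≟ₛ_ : (p q : Subset n) → Dec (p ≡ q)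
_≟ₛ_ = Vecₚ.≡-dec Boolₚ._≟_

_∈?_ : (p : Subset n) (ps : List (Subset n)) → Dec (p ∈ ps)
p ∈? ps = Any.any? (p ≟ₛ_) ps

range : Vec (Fin n) k → Subset n
range []       = Subset.⊥
range (x ∷ xs) = ⁅ x ⁆ ∪ range xs

∈-range⁺ : ∀ {x} {xs : Vec (Fin n) k} → x ∈ᵥ xs → x Subset.∈ range xs
∈-range⁺ (Anyᵥ.here refl) = x∈p∪q⁺ (inj₁ (x∈⁅x⁆ _))
∈-range⁺ (Anyᵥ.there p)   = x∈p∪q⁺ (inj₂ (∈-range⁺ p))

∈-range⁻ : ∀ {x} (xs : Vec (Fin n) k) → x Subset.∈ range xs → x ∈ᵥ xs
∈-range⁻ []       p = ⊥-elim (∉⊥ p)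
∈-range⁻ (y ∷ xs) p with x∈p∪q⁻ ⁅ y ⁆ (range xs) p
... | inj₁ q = Anyᵥ.here (x∈⁅y⁆⇒x≡y y q)
... | inj₂ q = Anyᵥ.there (∈-range⁻ xs q)

range-cong : ∀ {j} (xs : Vec (Fin n) k) (ys : Vec (Fin n) j) →
  (∀ {x} → x ∈ᵥ xs → x ∈ᵥ ys) → (∀ {x} → x ∈ᵥ ys → x ∈ᵥ xs) → range xs ≡ range ys
range-cong xs ys f g = ⊆-antisym (∈-range⁺ ∘ f ∘ ∈-range⁻ xs) (∈-range⁺ ∘ g ∘ ∈-range⁻ ys)

∣⁅x⁆∪p∣≤1+∣p∣ : ∀ x (p : Subset n) → ∣ ⁅ x ⁆ ∪ p ∣ ℕ.≤ suc ∣ p ∣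
∣⁅x⁆∪p∣≤1+∣p∣ zero    (true ∷ p)  = ℕₚ.≤-trans (ℕₚ.≤-reflexive (cong (suc ∘ ∣_∣) (∪-identityˡ p))) (ℕₚ.n≤1+n _)
∣⁅x⁆∪p∣≤1+∣p∣ zero    (false ∷ p) = ℕₚ.≤-reflexive (cong (suc ∘ ∣_∣) (∪-identityˡ p))
∣⁅x⁆∪p∣≤1+∣p∣ (suc x) (true ∷ p)  = s≤s (∣⁅x⁆∪p∣≤1+∣p∣ x p)
∣⁅x⁆∪p∣≤1+∣p∣ (suc x) (false ∷ p) = ∣⁅x⁆∪p∣≤1+∣p∣ x p

∣range∣≤ : (xs : Vec (Fin n) k) → ∣ range xs ∣ ℕ.≤ k
∣range∣≤ {n = n} [] = ℕₚ.≤-reflexive (∣⊥∣≡0 n)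
∣range∣≤ (x ∷ xs) = ℕₚ.≤-trans (∣⁅x⁆∪p∣≤1+∣p∣ x (range xs)) (s≤s (∣range∣≤ xs))

-- If the head recurred in the tail, dropping it would not change the range, whose size would then
-- be at most k. Applied to edges, this gives the distinctness of the vertices of an embedded daisy.
∣range∣≡⇒Unique : (xs : Vec (Fin n) k) → ∣ range xs ∣ ≡ k → Uniqueᵥ xs
∣range∣≡⇒Unique [] _ = []
∣range∣≡⇒Unique {k = suc k} (x ∷ xs) eq = lookup⁻ fresh ∷
    ∣range∣≡⇒Unique xs (ℕₚ.≤-antisym (∣range∣≤ xs) (ℕ.s≤s⁻¹ (subst (ℕ._≤ _) eq (∣⁅x⁆∪p∣≤1+∣p∣ x (range xs)))))
  where
  fresh : ∀ i → x ≢ lookup xs i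
  fresh i refl = ℕₚ.<-irrefl refl (subst (ℕ._≤ k) (trans (sym (cong ∣_∣ same)) eq) (∣range∣≤ xs))
    where
    same : range (x ∷ xs) ≡ range xs
    same = range-cong (x ∷ xs) xs (λ { (Anyᵥ.here refl) → ∈-lookup i xs ; (Anyᵥ.there p) → p }) Anyᵥ.there

-- Sums over tuples of vertices

∑ᵏ : ∀ k → (Vec (Fin n) k → ℤ) → ℤ
∑ᵏ zero    φ = φ []
∑ᵏ (suc k) φ = ∑ᵏ k (λ xs → ∑[ x ] φ (x ∷ xs))

∑ᵏ-posLinear : ∀ k → PosLinear (∑ᵏ {n} k)
∑ᵏ-posLinear zero = record { Λ-cong = λ h → h [] ; Λ-+ = λ _ _ → refl ; Λ-* = λ _ _ → refl ; Λ-mono = λ h → h [] }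
∑ᵏ-posLinear {n} (suc k) = record
  { Λ-cong = λ h → P.Λ-cong λ xs → ∑-cong λ x → h (x ∷ xs)
  ; Λ-+ = λ f g → trans (P.Λ-cong λ xs → ∑-+ _ _) (P.Λ-+ _ _)
  ; Λ-* = λ c f → trans (P.Λ-cong λ xs → ∑-* _ _) (P.Λ-* _ _)
  ; Λ-mono = λ h → P.Λ-mono λ xs → ∑-mono λ x → h (x ∷ xs) }
  where module P = PosLinear (∑ᵏ-posLinear {n} k)

∑ᵏ-comm : ∀ k {m} (ψ : Fin m → Vec (Fin n) k → ℤ) → ∑ᵏ k (λ xs → ∑[ x ] ψ x xs) ≡ (∑[ x ] ∑ᵏ k (ψ x))
∑ᵏ-comm zero    ψ = refl
∑ᵏ-comm (suc k) ψ = trans (PosLinear.Λ-cong (∑ᵏ-posLinear k) λ xs → ∑-comm _) (∑ᵏ-comm k _)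

∑ᵏ-const : ∀ k c → ∑ᵏ {n} k (λ _ → c) ≡ + (n ℕ.^ k) * c
∑ᵏ-const zero c = sym (1* c)
∑ᵏ-const {n} (suc k) c = trans (∑ᵏ-const k _) (trans (cong (+ (n ℕ.^ k) *_) (∑-const c))
  (trans (sym (*-assoc _ _ _)) (cong (_* c) (trans (*-comm _ _) (sym (pos-* n (n ℕ.^ k)))))))

opaque
  unfolding ∑

  ∑-∣∣ : (p : Subset n) → (∑[ x ] ⟦ lookup p x ⟧) ≡ + ∣ p ∣
  ∑-∣∣ []          = refl
  ∑-∣∣ (true ∷ p)  = cong (ℤ._+_ 1ℤ) (∑-∣∣ p)
  ∑-∣∣ (false ∷ p) = trans (ℤₚ.+-identityˡ _) (∑-∣∣ p)

remove : (p : Subset n) (x : Fin n) → lookup p x ≡ true → ∃ λ q → (∣ p ∣ ≡ suc ∣ q ∣) × (⁅ x ⁆ ∪ q ≡ p)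
remove (true ∷ p) zero    _ = false ∷ p , refl , cong (true ∷_) (∪-identityˡ p)
remove (b ∷ p)    (suc x) h with remove p x h
remove (true ∷ p)  (suc x) h | q , eq , u = true ∷ q , cong suc eq , cong (true ∷_) u
remove (false ∷ p) (suc x) h | q , eq , u = false ∷ q , eq , cong (false ∷_) u

∣p∣≡0⇒p≡⊥ : (p : Subset n) → ∣ p ∣ ≡ 0 → p ≡ Subset.⊥
∣p∣≡0⇒p≡⊥ []          _ = refl
∣p∣≡0⇒p≡⊥ (false ∷ p) h = cong (false ∷_) (∣p∣≡0⇒p≡⊥ p h)

⟦does⟧-mono : ∀ {P Q : Set} (p? : Dec P) (q? : Dec Q) → (P → Q) → ⟦ does p? ⟧ ≤ ⟦ does q? ⟧
⟦does⟧-mono (no _)  q? h = 0≤⟦ does q? ⟧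
⟦does⟧-mono (yes p) q? h = ≤-reflexive (cong ⟦_⟧ (sym (dec-true q? (h p))))

orderings : ∀ k (p : Subset n) → ∣ p ∣ ≡ k → + (k !) ≤ ∑ᵏ k (λ xs → ⟦ does (range xs ≟ₛ p) ⟧)
orderings zero p h = ≤-reflexive (cong ⟦_⟧ (sym (dec-true (range [] ≟ₛ p) (sym (∣p∣≡0⇒p≡⊥ p h)))))
orderings (suc k) p h = ≤-trans (≤-reflexive total) (≤-trans (∑-mono local) (≤-reflexive (sym (∑ᵏ-comm k _))))
  where
  total : + (suc k !) ≡ (∑[ x ] ⟦ lookup p x ⟧ * + (k !))
  total = trans (pos-* (suc k) (k !)) (trans (cong (_* + (k !)) (trans (cong +_ (sym h)) (sym (∑-∣∣ p)))) (sym (∑-*ʳ _ _)))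
  local : ∀ x → ⟦ lookup p x ⟧ * + (k !) ≤ ∑ᵏ k (λ xs → ⟦ does (range (x ∷ xs) ≟ₛ p) ⟧)
  local x with lookup p x in eq
  ... | false = ≤-trans (≤-reflexive (*-zeroˡ _)) (PosLinear.Λ-nonneg (∑ᵏ-posLinear k) λ xs → 0≤⟦ _ ⟧)
  ... | true with remove p x eq
  ...   | q , sz , u = ≤-trans (≤-reflexive (1* _)) (≤-trans (orderings k q (ℕₚ.suc-injective (trans (sym sz) h)))
            (PosLinear.Λ-mono (∑ᵏ-posLinear k) λ xs → ⟦does⟧-mono (range xs ≟ₛ q) (range (x ∷ xs) ≟ₛ p) λ e → trans (cong (⁅ x ⁆ ∪_) e) u))

edge-tuples : ∀ k (es : List (Subset n)) → Unique es → All (λ e → ∣ e ∣ ≡ k) es →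
  + (k !) * + length es ≤ ∑ᵏ k (λ xs → ⟦ does (range xs ∈? es) ⟧)
edge-tuples k [] _ _ = ≤-trans (≤-reflexive (*-zeroʳ _)) (PosLinear.Λ-nonneg (∑ᵏ-posLinear k) λ xs → ≤-refl)
edge-tuples {n = n} k (e ∷ es) (e∉ ∷ uniq) (sz ∷ szs) =
  ≤-trans (≤-reflexive (trans (cong (+ (k !) *_) (+-suc (length es))) (i _ _)))
    (≤-trans (+-mono-≤ (orderings k e sz) (edge-tuples k es uniq szs))
      (≤-trans (≤-reflexive (sym (PosLinear.Λ-+ (∑ᵏ-posLinear k) _ _))) (PosLinear.Λ-mono (∑ᵏ-posLinear k) local)))
  where
  opaque
    unfolding _+_
    i : ∀ a b → a * (1ℤ + b) ≡ a + a * b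
    i = solve-∀
    id0 : ∀ a → 0ℤ + a ≡ a
    id0 = solve-∀
    id0ʳ : ∀ a → a + 0ℤ ≡ a
    id0ʳ = solve-∀
  local : ∀ (xs : Vec (Fin n) k) → ⟦ does (range xs ≟ₛ e) ⟧ + ⟦ does (range xs ∈? es) ⟧ ≤ ⟦ does (range xs ∈? (e ∷ es)) ⟧
  local xs with range xs ≟ₛ e
  ... | no _    = ≤-reflexive (id0 _)
  ... | yes eq rewrite dec-false (range xs ∈? es) (λ p → All.lookup e∉ p (sym eq)) = ≤-reflexive (id0ʳ 1ℤ)

-- Embedding daisies

∈-elems⁺ : ∀ {m} (p : Subset m) {u} → u Subset.∈ p → u ∈ elems p
∈-elems⁺ (true ∷ p)  Vec.here      = here refl
∈-elems⁺ (true ∷ p)  (Vec.there h) = there (∈-map⁺ suc (∈-elems⁺ p h))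
∈-elems⁺ (false ∷ p) (Vec.there h) = ∈-map⁺ suc (∈-elems⁺ p h)

∈-elems⁻ : ∀ {m} (p : Subset m) {u} → u ∈ elems p → u Subset.∈ p
∈-elems⁻ (true ∷ p) (here refl) = Vec.here
∈-elems⁻ (true ∷ p) (there h) with ∈-map⁻ suc h
... | _ , q , refl = Vec.there (∈-elems⁻ p q)
∈-elems⁻ (false ∷ p) h with ∈-map⁻ suc h
... | _ , q , refl = Vec.there (∈-elems⁻ p q)

∈-⋃⁺ : ∀ {m} (f : Fin m → Fin n) us {u} → u ∈ us → f u Subset.∈ ⋃ (List.map (λ u → ⁅ f u ⁆) us)
∈-⋃⁺ f (_ ∷ us) (here refl) = x∈p∪q⁺ (inj₁ (x∈⁅x⁆ _))
∈-⋃⁺ f (_ ∷ us) (there h)   = x∈p∪q⁺ (inj₂ (∈-⋃⁺ f us h))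

∈-⋃⁻ : ∀ {m} (f : Fin m → Fin n) us {x} → x Subset.∈ ⋃ (List.map (λ u → ⁅ f u ⁆) us) → ∃ λ u → u ∈ us × x ≡ f u
∈-⋃⁻ f [] h = ⊥-elim (∉⊥ h)
∈-⋃⁻ f (v ∷ us) h with x∈p∪q⁻ ⁅ f v ⁆ _ h
... | inj₁ q = v , here refl , x∈⁅y⁆⇒x≡y _ q
... | inj₂ q with ∈-⋃⁻ f us q
...   | u , u∈ , eq = u , there u∈ , eq

∈-image⁺ : ∀ {m} (f : Fin m → Fin n) p {u} → u Subset.∈ p → f u Subset.∈ image f p
∈-image⁺ f p h = ∈-⋃⁺ f (elems p) (∈-elems⁺ p h)

∈-image⁻ : ∀ {m} (f : Fin m → Fin n) p {x} → x Subset.∈ image f p → ∃ λ u → u Subset.∈ p × x ≡ f u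
∈-image⁻ f p h with ∈-⋃⁻ f (elems p) h
... | u , u∈ , eq = u , ∈-elems⁻ p u∈ , eq

∈-suspendEdge⁺ˡ : ∀ {m} k (p : Subset m) i → (i ↑ˡ m) Subset.∈ suspendEdge k p
∈-suspendEdge⁺ˡ (suc k) p zero    = Vec.here
∈-suspendEdge⁺ˡ (suc k) p (suc i) = Vec.there (∈-suspendEdge⁺ˡ k p i)

∈-suspendEdge⁺ʳ : ∀ {m} k (p : Subset m) {i} → i Subset.∈ p → (k ↑ʳ i) Subset.∈ suspendEdge k p
∈-suspendEdge⁺ʳ zero    p h = h
∈-suspendEdge⁺ʳ (suc k) p h = Vec.there (∈-suspendEdge⁺ʳ k p h)

∈-suspendEdge⁻ʳ : ∀ {m} k (p : Subset m) {i} → (k ↑ʳ i) Subset.∈ suspendEdge k p → i Subset.∈ p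
∈-suspendEdge⁻ʳ zero    p h = h
∈-suspendEdge⁻ʳ (suc k) p (Vec.there h) = ∈-suspendEdge⁻ʳ k p h

∈-Kedges⁻ : ∀ t {e} → e ∈ Kedges t → ∃ λ i → ∃ λ j → i Fin.< j × e ≡ ⁅ i ⁆ ∪ ⁅ j ⁆
∈-Kedges⁻ t h with Any.satisfied (∈-concatMap⁻ _ {xs = List.allFin t} h)
... | j , q with ∈-map⁻ _ q
...   | i , i∈ , eq = i , j , proj₂ (∈-filter⁻ (λ i → i Fin.<? j) {xs = List.allFin t} i∈) , eq

All-lookup : ∀ {A : Set} {P : A → Set} {xs : List A} → All P xs → ∀ i → P (List.lookup xs i)
All-lookup (p ∷ ps) zero    = p
All-lookup (p ∷ ps) (suc i) = All-lookup ps i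

AllPairs-lookup : ∀ {A : Set} {S : A → A → Set} {xs : List A} → AllPairs S xs →
  ∀ {i j} → i Fin.< j → S (List.lookup xs i) (List.lookup xs j)
AllPairs-lookup (p ∷ ps) {zero}  {suc j} _         = All-lookup p j
AllPairs-lookup (p ∷ ps) {suc i} {suc j} (s≤s h) = AllPairs-lookup ps h

-- Distinctness of the embedded vertices is read off from edges, each of which has as many elements
-- as its tuple has entries. Two petals are listed explicitly so that there is at least one edge
-- through the stem.
module Embed (H : RGraph (3 ℕ.+ k) n) (v : Fin n) (s : Vec (Fin n) k) (x₀ x₁ : Fin n) (xs : List (Fin n))
  (pairs : AllPairs (λ x y → range (v ∷ x ∷ y ∷ s) ∈ edges H) (x₀ ∷ x₁ ∷ xs)) where

  petals : List (Fin n)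
  petals = x₀ ∷ x₁ ∷ xs

  stem : Vec (Fin n) (suc k)
  stem = v ∷ s

  pick : Fin (suc k) ⊎ Fin (length petals) → Fin n
  pick = Sum.[ lookup stem , List.lookup petals ]

  f : Fin (suc k ℕ.+ length petals) → Fin n
  f u = pick (splitAt (suc k) u)

  f-↑ˡ : ∀ i → f (i ↑ˡ length petals) ≡ lookup stem i
  f-↑ˡ i = cong pick (Finₚ.splitAt-↑ˡ (suc k) i (length petals))

  f-↑ʳ : ∀ i → f (suc k ↑ʳ i) ≡ List.lookup petals i
  f-↑ʳ i = cong pick (Finₚ.splitAt-↑ʳ (suc k) (length petals) i)

  unique-tuple : ∀ {i j : Fin (length petals)} → i Fin.< j → Uniqueᵥ (v ∷ List.lookup petals i ∷ List.lookup petals j ∷ s)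
  unique-tuple h = ∣range∣≡⇒Unique _ (All.lookup (uniform H) (AllPairs-lookup pairs h))

  stem-unique : Uniqueᵥ stem
  stem-unique with unique-tuple {zero} {suc zero} (s≤s z≤n)
  ... | (_ ∷ _ ∷ v∉s) ∷ _ ∷ _ ∷ us = v∉s ∷ us

  first-≢ : ∀ {i j : Fin (length petals)} → i Fin.< j → ∀ p → lookup stem p ≢ List.lookup petals i
  first-≢ h p eq with unique-tuple h
  first-≢ h zero    eq | (v≢ ∷ _) ∷ _ = v≢ eq
  first-≢ h (suc p) eq | _ ∷ (_ ∷ x∉s) ∷ _ = lookup⁺ x∉s p (sym eq)

  second-≢ : ∀ {i j : Fin (length petals)} → i Fin.< j → ∀ p → lookup stem p ≢ List.lookup petals j
  second-≢ h p eq with unique-tuple h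
  second-≢ h zero    eq | (_ ∷ v≢ ∷ _) ∷ _ = v≢ eq
  second-≢ h (suc p) eq | _ ∷ _ ∷ x∉s ∷ _ = lookup⁺ x∉s p (sym eq)

  stem≢petal : ∀ p i → lookup stem p ≢ List.lookup petals i
  -- The first petal comes first in the pair (x₀, x₁); any other petal comes second in a pair that
  -- starts with x₀.
  stem≢petal p zero    = first-≢ {zero} {suc zero} (s≤s z≤n) p
  stem≢petal p (suc i) = second-≢ {zero} {suc i} (s≤s z≤n) p

  petals-distinct : ∀ {i j : Fin (length petals)} → i Fin.< j → List.lookup petals i ≢ List.lookup petals j
  petals-distinct h with unique-tuple h
  ... | _ ∷ (x≢y ∷ _) ∷ _ = x≢y

  petals-injective : ∀ i j → List.lookup petals i ≡ List.lookup petals j → i ≡ j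
  petals-injective i j eq with Finₚ.<-cmp i j
  ... | tri< h _ _ = ⊥-elim (petals-distinct h eq)
  ... | tri≈ _ h _ = h
  ... | tri> _ _ h = ⊥-elim (petals-distinct h (sym eq))

  pick-injective : ∀ p q → pick p ≡ pick q → p ≡ q
  pick-injective (inj₁ i) (inj₁ j) eq = cong inj₁ (lookup-injective stem-unique i j eq)
  pick-injective (inj₁ i) (inj₂ j) eq = ⊥-elim (stem≢petal i j eq)
  pick-injective (inj₂ i) (inj₁ j) eq = ⊥-elim (stem≢petal j i (sym eq))
  pick-injective (inj₂ i) (inj₂ j) eq = cong inj₂ (petals-injective i j eq)

  f-injective : Injective _≡_ _≡_ f
  f-injective {u} {u'} eq = begin
    u                                                      ≡⟨ Finₚ.join-splitAt (suc k) _ u ⟨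
    Fin.join (suc k) _ (splitAt (suc k) u)                 ≡⟨ cong (Fin.join (suc k) _) (pick-injective (splitAt (suc k) u) (splitAt (suc k) u') eq) ⟩
    Fin.join (suc k) _ (splitAt (suc k) u')                ≡⟨ Finₚ.join-splitAt (suc k) _ u' ⟩
    u'                                                     ∎
    where open ≡-Reasoning

  image-daisy-edge : ∀ i j → image f (suspendEdge (suc k) (⁅ i ⁆ ∪ ⁅ j ⁆)) ≡ range (v ∷ List.lookup petals i ∷ List.lookup petals j ∷ s)
  image-daisy-edge i j = ⊆-antisym fwd (λ h → bwd (∈-range⁻ tuple h))
    where
    p = suspendEdge (suc k) (⁅ i ⁆ ∪ ⁅ j ⁆)
    tuple = v ∷ List.lookup petals i ∷ List.lookup petals j ∷ s
    stem⊆ : ∀ q → lookup stem q ∈ᵥ tuple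
    stem⊆ zero    = Anyᵥ.here refl
    stem⊆ (suc q) = Anyᵥ.there (Anyᵥ.there (Anyᵥ.there (∈-lookup q s)))
    value : ∀ w u → suc k Fin.↑ʳ w ≡ u → u Subset.∈ p → List.lookup petals w ∈ᵥ tuple
    value w .(suc k ↑ʳ w) refl h with x∈p∪q⁻ ⁅ i ⁆ ⁅ j ⁆ (∈-suspendEdge⁻ʳ (suc k) _ h)
    ... | inj₁ q rewrite x∈⁅y⁆⇒x≡y i q = Anyᵥ.there (Anyᵥ.here refl)
    ... | inj₂ q rewrite x∈⁅y⁆⇒x≡y j q = Anyᵥ.there (Anyᵥ.there (Anyᵥ.here refl))
    fwd : ∀ {x} → x Subset.∈ image f p → x Subset.∈ range tuple
    fwd h with ∈-image⁻ f p h
    ... | u , u∈ , refl with splitAt (suc k) u in eq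
    ...   | inj₁ q = ∈-range⁺ (stem⊆ q)
    ...   | inj₂ w = ∈-range⁺ (value w u (Finₚ.splitAt⁻¹-↑ʳ {m = suc k} eq) u∈)
    stem∈ : ∀ q → lookup stem q Subset.∈ image f p
    stem∈ q = subst (Subset._∈ image f p) (f-↑ˡ q) (∈-image⁺ f p (∈-suspendEdge⁺ˡ (suc k) _ q))
    petal∈ : ∀ w → w Subset.∈ (⁅ i ⁆ ∪ ⁅ j ⁆) → List.lookup petals w Subset.∈ image f p
    petal∈ w h = subst (Subset._∈ image f p) (f-↑ʳ w) (∈-image⁺ f p (∈-suspendEdge⁺ʳ (suc k) _ h))
    bwd : ∀ {x} → x ∈ᵥ tuple → x Subset.∈ image f p
    bwd (Anyᵥ.here refl)                           = stem∈ zero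
    bwd (Anyᵥ.there (Anyᵥ.here refl))              = petal∈ i (x∈p∪q⁺ (inj₁ (x∈⁅x⁆ i)))
    bwd (Anyᵥ.there (Anyᵥ.there (Anyᵥ.here refl))) = petal∈ j (x∈p∪q⁺ (inj₂ (x∈⁅x⁆ j)))
    bwd (Anyᵥ.there (Anyᵥ.there (Anyᵥ.there h)))   =
      subst (Subset._∈ image f p) (sym (lookup-index h)) (stem∈ (suc (Anyᵥ.index h)))

  contains : Contains H (daisy (3 ℕ.+ k) (length petals))
  contains = f , f-injective , All.tabulate λ h → edge (∈-map⁻ (suspendEdge (suc k)) h)
    where
    edge : ∀ {e} → ∃ (λ e' → e' ∈ Kedges (length petals) × e ≡ suspendEdge (suc k) e') → image f e ∈ edges H
    edge (e' , h , refl) with ∈-Kedges⁻ (length petals) h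
    ... | i , j , i<j , refl = subst (_∈ edges H) (sym (image-daisy-edge i j)) (AllPairs-lookup pairs i<j)

-- Non-edges over a fixed tuple of r - 3 vertices

module _ (H : RGraph (3 ℕ.+ k) n) (s : Vec (Fin n) k) where
  -- A tuple with a repeated entry has too small a range to be an edge, so degenerate triples are
  -- non-edges. The links thus carry loops, and sums over triples need no distinctness conditions.
  nonEdge : Fin n → Fin n → Fin n → Bool
  nonEdge x y z = not (does (range (x ∷ y ∷ z ∷ s) ∈? edges H))

  nonEdge-sym₁ : ∀ x y z → nonEdge x y z ≡ nonEdge y x z
  nonEdge-sym₁ x y z = cong (λ p → not (does (p ∈? edges H))) (range-cong (x ∷ y ∷ z ∷ s) (y ∷ x ∷ z ∷ s) swap swap)
    where
    swap : ∀ {x y} {ws : Vec (Fin n) (suc k)} {w} → w ∈ᵥ (x ∷ y ∷ ws) → w ∈ᵥ (y ∷ x ∷ ws)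
    swap (Anyᵥ.here e)              = Anyᵥ.there (Anyᵥ.here e)
    swap (Anyᵥ.there (Anyᵥ.here e)) = Anyᵥ.here e
    swap (Anyᵥ.there (Anyᵥ.there h)) = Anyᵥ.there (Anyᵥ.there h)

  nonEdge-sym₂ : ∀ x y z → nonEdge x y z ≡ nonEdge x z y
  nonEdge-sym₂ x y z = cong (λ p → not (does (p ∈? edges H))) (range-cong (x ∷ y ∷ z ∷ s) (x ∷ z ∷ y ∷ s) swap swap)
    where
    swap : ∀ {x y z} {ws : Vec (Fin n) k} {w} → w ∈ᵥ (x ∷ y ∷ z ∷ ws) → w ∈ᵥ (x ∷ z ∷ y ∷ ws)
    swap (Anyᵥ.here e)                           = Anyᵥ.here e
    swap (Anyᵥ.there (Anyᵥ.here e))              = Anyᵥ.there (Anyᵥ.there (Anyᵥ.here e))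
    swap (Anyᵥ.there (Anyᵥ.there (Anyᵥ.here e))) = Anyᵥ.there (Anyᵥ.here e)
    swap (Anyᵥ.there (Anyᵥ.there (Anyᵥ.there h))) = Anyᵥ.there (Anyᵥ.there (Anyᵥ.there h))

  no-independent : ∀ t → (Contains H (daisy (3 ℕ.+ k) (suc (suc t))) → ⊥) →
    ∀ v xs → length xs ≡ suc (suc t) → AllPairs (λ x y → nonEdge v x y ≡ false) xs → ⊥
  no-independent .(length xs) free v (x₀ ∷ x₁ ∷ xs) refl pairs =
    free (Embed.contains H v s x₀ x₁ xs (AllPairs.map (λ {x} {y} → edge x y) pairs))
    where
    edge : ∀ x y → nonEdge v x y ≡ false → range (v ∷ x ∷ y ∷ s) ∈ edges H
    edge x y h with range (v ∷ x ∷ y ∷ s) ∈? edges H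
    ... | yes p = p

  triple-count : ∀ t → 2 ℕ.≤ t → 15 ℕ.* t ℕ.≤ n → (Contains H (daisy (3 ℕ.+ k) (suc t)) → ⊥) →
    + 12 * (+ t * + t) * (∑[ z ] ∑[ y ] ∑[ x ] ⟦ does (range (x ∷ y ∷ z ∷ s) ∈? edges H) ⟧) ≤
      (+ 12 * (+ t * + t) - + 12 * + t - 1ℤ) * (+ n * (+ n * + n))
  triple-count zero ()
  triple-count t@(suc t') 2≤t big free = by-gap (gap (triple-density nonEdge nonEdge-sym₁ nonEdge-sym₂ t 2≤t big (no-independent t' free)))
      (trans (cong (λ q → (+ 12 * (+ t * + t) - + 12 * + t - 1ℤ) * (+ n * (+ n * + n)) - + 12 * (+ t * + t) * q) count) (i (+ t) (+ n) _))
    where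
    opaque
      unfolding _+_
      i : ∀ t n E → (+ 12 * (t * t) - + 12 * t - 1ℤ) * (n * (n * n)) - + 12 * (t * t) * (n * (n * n) - E) ≡
        + 12 * (t * (t * E - n * (n * n))) - n * (n * n)
      i = solve-∀
      ⟦not⟧ : ∀ b → ⟦ b ⟧ ≡ 1ℤ - ⟦ not b ⟧
      ⟦not⟧ true  = refl
      ⟦not⟧ false = refl
    reorder : ∀ (φ : Fin n → Fin n → Fin n → ℤ) → (∑[ z ] ∑[ y ] ∑[ x ] φ x y z) ≡ (∑[ x ] ∑[ y ] ∑[ z ] φ x y z)
    reorder φ = trans (∑-comm _) (trans (∑-cong λ y → ∑-comm _) (∑-comm _))
    count : (∑[ z ] ∑[ y ] ∑[ x ] ⟦ does (range (x ∷ y ∷ z ∷ s) ∈? edges H) ⟧) ≡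
      + n * (+ n * + n) - (∑[ x ] ∑[ y ] ∑[ z ] ⟦ nonEdge x y z ⟧)
    count = trans (reorder _) (trans (∑-cong λ x → ∑-cong λ y → ∑-cong λ z → ⟦not⟧ (does (range (x ∷ y ∷ z ∷ s) ∈? edges H)))
      (trans (∑-cong λ x → trans (∑-cong λ y → trans (∑-- _ _) (cong₂ _-_ (trans (∑-const 1ℤ) (*1 _)) refl))
        (trans (∑-- _ _) (cong₂ _-_ (∑-const _) refl))) (trans (∑-- _ _) (cong₂ _-_ (∑-const _) refl))))

-- `∑ᵏ` sums the head innermost, so `∑ᵏ (3 ℕ.+ k)` is by conversion a sum over k-tuples s of sums
-- over triples, and `triple-count` applies to each s.
edge-bound : ∀ {k n} (H : RGraph (3 ℕ.+ k) n) t → 2 ℕ.≤ t → 15 ℕ.* t ℕ.≤ n → (Contains H (daisy (3 ℕ.+ k) (suc t)) → ⊥) →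
  + 12 * (+ t * + t) * (+ ((3 ℕ.+ k) !) * + e[ H ]) ≤
    (+ 12 * (+ t * + t) - + 12 * + t - 1ℤ) * (+ (n ℕ.^ k) * (+ n * (+ n * + n)))
edge-bound {k} {n} H t 2≤t big free = ≤-trans
  (*-monoˡ (0≤* {+ 12} 0≤+n (0≤* {+ t} 0≤+n 0≤+n)) (edge-tuples (3 ℕ.+ k) (edges H) (unique H) (uniform H)))
  (≤-trans (≤-reflexive (sym (PosLinear.Λ-* (∑ᵏ-posLinear k) _ _)))
  (≤-trans (PosLinear.Λ-mono (∑ᵏ-posLinear k) λ s → triple-count H s t 2≤t big free)
    (≤-reflexive (trans (∑ᵏ-const k _) (i _ _ _)))))
  where
  opaque
    unfolding _+_
    i : ∀ a b c → a * (b * c) ≡ b * (a * c)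
    i = solve-∀

-- Binomial coefficients and rational bounds

nCk*k!≡nP′k : ∀ {n k} → k ℕ.≤ n → (n C k) ℕ.* k ! ≡ n P′ k
nCk*k!≡nP′k {n} {k} k≤n = trans (cong (ℕ._* k !) (trans (nCk≡n!/k![n-k]! k≤n) (sym (nC′k≡n!/k![n-k]! k≤n))))
  (ℕ.m/n*n≡m {{ℕₚ._!≢0 k}} (k!∣nP′k k≤n))

nP′k≤n^k : ∀ n k → n P′ k ℕ.≤ n ^ k
nP′k≤n^k n zero    = ℕₚ.≤-refl
nP′k≤n^k n (suc k) = ℕₚ.*-mono-≤ (ℕₚ.m∸n≤m n k) (nP′k≤n^k n k)

-- Passing to the next factor n - k adds a loss of at most k * n^(k+1), and k² + k ≤ (k + 1)². The
-- outer factor n clears the denominator of 1 - k²/n.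
n^k≤nP′k : ∀ {n k} → k ℕ.≤ n → n ℕ.* n ^ k ℕ.≤ n ℕ.* (n P′ k) ℕ.+ k ℕ.* k ℕ.* n ^ k
n^k≤nP′k {n} {zero}  _   = ℕₚ.m≤m+n _ _
n^k≤nP′k {n} {suc k} k<n = begin
  n ℕ.* (n ℕ.* M)                                                       ≤⟨ ℕₚ.*-monoʳ-≤ n (n^k≤nP′k (ℕₚ.<⇒≤ k<n)) ⟩
  n ℕ.* (n ℕ.* P ℕ.+ k ℕ.* k ℕ.* M)                                       ≡⟨ cong (λ q → q ℕ.* (n ℕ.* P ℕ.+ k ℕ.* k ℕ.* M)) (sym n≡) ⟩
  (d ℕ.+ k) ℕ.* (n ℕ.* P ℕ.+ k ℕ.* k ℕ.* M)                               ≡⟨ i d k n P M ⟩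
  n ℕ.* (d ℕ.* P) ℕ.+ k ℕ.* (n ℕ.* P) ℕ.+ k ℕ.* k ℕ.* ((d ℕ.+ k) ℕ.* M)         ≡⟨ cong (λ q → n ℕ.* (d ℕ.* P) ℕ.+ k ℕ.* (n ℕ.* P) ℕ.+ k ℕ.* k ℕ.* (q ℕ.* M)) n≡ ⟩
  n ℕ.* (d ℕ.* P) ℕ.+ k ℕ.* (n ℕ.* P) ℕ.+ k ℕ.* k ℕ.* (n ℕ.* M)               ≤⟨ ℕₚ.+-monoˡ-≤ (k ℕ.* k ℕ.* (n ℕ.* M)) (ℕₚ.+-monoʳ-≤ (n ℕ.* (d ℕ.* P)) (ℕₚ.*-monoʳ-≤ k (ℕₚ.*-monoʳ-≤ n (nP′k≤n^k n k)))) ⟩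
  n ℕ.* (d ℕ.* P) ℕ.+ k ℕ.* (n ℕ.* M) ℕ.+ k ℕ.* k ℕ.* (n ℕ.* M)               ≤⟨ ℕₚ.m≤m+n _ _ ⟩
  n ℕ.* (d ℕ.* P) ℕ.+ k ℕ.* (n ℕ.* M) ℕ.+ k ℕ.* k ℕ.* (n ℕ.* M) ℕ.+ (k ℕ.* (n ℕ.* M) ℕ.+ n ℕ.* M) ≡⟨ j k (n ℕ.* (d ℕ.* P)) (n ℕ.* M) ⟩
  n ℕ.* (d ℕ.* P) ℕ.+ suc k ℕ.* suc k ℕ.* (n ℕ.* M)                           ∎
  where
  open ℕₚ.≤-Reasoning
  M = n ^ k
  P = n P′ k
  d = n ∸ k
  n≡ : d ℕ.+ k ≡ n
  n≡ = ℕₚ.m∸n+n≡m (ℕₚ.<⇒≤ k<n)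
  i : ∀ d k n P M → (d ℕ.+ k) ℕ.* (n ℕ.* P ℕ.+ k ℕ.* k ℕ.* M) ≡ n ℕ.* (d ℕ.* P) ℕ.+ k ℕ.* (n ℕ.* P) ℕ.+ k ℕ.* k ℕ.* ((d ℕ.+ k) ℕ.* M)
  i = solve-∀ℕ
  j : ∀ k a b → a ℕ.+ k ℕ.* b ℕ.+ k ℕ.* k ℕ.* b ℕ.+ (k ℕ.* b ℕ.+ b) ≡ a ℕ.+ (1 ℕ.+ k) ℕ.* (1 ℕ.+ k) ℕ.* b
  j = solve-∀ℕ

-- Once n ≥ r² (q + 1), the relative loss r²/n in `n^k≤nP′k` is at most 1/(q + 1).
power≤falling : ∀ {n r} q → r ℕ.≤ n → 0 ℕ.< n → r ℕ.* r ℕ.* suc q ℕ.≤ n → q ℕ.* n ^ r ℕ.≤ suc q ℕ.* (n P′ r)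
power≤falling {n@(suc _)} {r} q r≤n _ big = ℕₚ.*-cancelˡ-≤ n (begin
  n ℕ.* (q ℕ.* M)                             ≡⟨ i n q M ⟩
  q ℕ.* (n ℕ.* M)                             ≤⟨ ℕₚ.*-monoʳ-≤ q (n^k≤nP′k r≤n) ⟩
  q ℕ.* (n ℕ.* P ℕ.+ r ℕ.* r ℕ.* M)             ≡⟨ ℕₚ.*-distribˡ-+ q _ _ ⟩
  q ℕ.* (n ℕ.* P) ℕ.+ q ℕ.* (r ℕ.* r ℕ.* M)       ≤⟨ ℕₚ.+-monoʳ-≤ (q ℕ.* (n ℕ.* P)) tail ⟩
  q ℕ.* (n ℕ.* P) ℕ.+ n ℕ.* P                   ≡⟨ j q n P ⟩
  n ℕ.* (suc q ℕ.* P)                         ∎)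
  where
  open ℕₚ.≤-Reasoning
  M = n ^ r
  P = n P′ r
  i : ∀ n q M → n ℕ.* (q ℕ.* M) ≡ q ℕ.* (n ℕ.* M)
  i = solve-∀ℕ
  j : ∀ q n P → q ℕ.* (n ℕ.* P) ℕ.+ n ℕ.* P ≡ n ℕ.* ((1 ℕ.+ q) ℕ.* P)
  j = solve-∀ℕ
  l : ∀ r q M → r ℕ.* r ℕ.* (1 ℕ.+ q) ℕ.* M ≡ q ℕ.* (r ℕ.* r ℕ.* M) ℕ.+ r ℕ.* r ℕ.* M
  l = solve-∀ℕ
  tail : q ℕ.* (r ℕ.* r ℕ.* M) ℕ.≤ n ℕ.* P
  tail = ℕₚ.+-cancelʳ-≤ (r ℕ.* r ℕ.* M) _ _ (begin
    q ℕ.* (r ℕ.* r ℕ.* M) ℕ.+ r ℕ.* r ℕ.* M     ≡⟨ l r q M ⟨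
    r ℕ.* r ℕ.* suc q ℕ.* M                   ≤⟨ ℕₚ.*-monoˡ-≤ M big ⟩
    n ℕ.* M                                 ≤⟨ n^k≤nP′k r≤n ⟩
    n ℕ.* P ℕ.+ r ℕ.* r ℕ.* M                 ∎)

edge-boundℕ : ∀ {k n} (H : RGraph (3 ℕ.+ k) n) t → 2 ℕ.≤ t → 15 ℕ.* t ℕ.≤ n → (Contains H (daisy (3 ℕ.+ k) (suc t)) → ⊥) →
  12 ℕ.* (t ℕ.* t) ℕ.* ((3 ℕ.+ k) ! ℕ.* e[ H ]) ℕ.+ (12 ℕ.* t ℕ.+ 1) ℕ.* n ^ (3 ℕ.+ k) ℕ.≤ 12 ℕ.* (t ℕ.* t) ℕ.* n ^ (3 ℕ.+ k)
edge-boundℕ {k} {n} H t 2≤t big free = ℤₚ.drop‿+≤+ (subst₂ _≤_ lhs rhs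
    (by-gap (gap (edge-bound H t 2≤t big free)) (i (+ t) (+ (n ^ k)) (+ n) (+ ((3 ℕ.+ k) !) * + e[ H ]))))
  where
  opaque
    unfolding _+_
    i : ∀ t m n e → + 12 * (t * t) * (n * (n * (n * m))) - (+ 12 * (t * t) * e + (+ 12 * t + 1ℤ) * (n * (n * (n * m)))) ≡
      (+ 12 * (t * t) - + 12 * t - 1ℤ) * (m * (n * (n * n))) - + 12 * (t * t) * e
    i = solve-∀
  power : + (n ^ (3 ℕ.+ k)) ≡ + n * (+ n * (+ n * + (n ^ k)))
  power = trans (pos-* n _) (cong (+ n *_) (trans (pos-* n _) (cong (+ n *_) (pos-* n _))))
  lhs = sym (trans (pos-+ _ _) (cong₂ _+_ (trans (pos-* (12 ℕ.* (t ℕ.* t)) _) (cong₂ _*_ (pos-*³ 12 t t) (pos-* ((3 ℕ.+ k) !) e[ H ])))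
    (trans (pos-* (12 ℕ.* t ℕ.+ 1) _) (cong₂ _*_ (trans (pos-+ (12 ℕ.* t) 1) (cong (_+ 1ℤ) (pos-* 12 t))) power))))
  rhs = sym (trans (pos-* (12 ℕ.* (t ℕ.* t)) _) (cong₂ _*_ (pos-*³ 12 t t) power))

-- For q > 0, division by 12t² q gives the density 1 - 1/t - 1/(12t²) + 1/q: passing from powers to
-- binomials costs 1/q, which will be at most ε.
edge-bound-C : ∀ {k n} (H : RGraph (3 ℕ.+ k) n) t q → 2 ℕ.≤ t → 15 ℕ.* t ℕ.≤ n → 3 ℕ.+ k ℕ.≤ n →
  (3 ℕ.+ k) ℕ.* (3 ℕ.+ k) ℕ.* suc q ℕ.≤ n → (Contains H (daisy (3 ℕ.+ k) (suc t)) → ⊥) →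
  q ℕ.* (12 ℕ.* (t ℕ.* t)) ℕ.* e[ H ] ℕ.+ q ℕ.* (12 ℕ.* t ℕ.+ 1) ℕ.* (n C (3 ℕ.+ k)) ℕ.≤ suc q ℕ.* (12 ℕ.* (t ℕ.* t)) ℕ.* (n C (3 ℕ.+ k))
edge-bound-C {k} {n} H t q 2≤t big r≤n big' free = ℕₚ.*-cancelˡ-≤ (r !) {{ℕₚ._!≢0 r}} (begin
  r ! ℕ.* (q ℕ.* a ℕ.* e ℕ.+ q ℕ.* b ℕ.* c)              ≡⟨ i (r !) q a e b c ⟩
  q ℕ.* (a ℕ.* (r ! ℕ.* e) ℕ.+ b ℕ.* (c ℕ.* r !))        ≡⟨ cong (λ p → q ℕ.* (a ℕ.* (r ! ℕ.* e) ℕ.+ b ℕ.* p)) (nCk*k!≡nP′k r≤n) ⟩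
  q ℕ.* (a ℕ.* (r ! ℕ.* e) ℕ.+ b ℕ.* (n P′ r))           ≤⟨ ℕₚ.*-monoʳ-≤ q (ℕₚ.+-monoʳ-≤ _ (ℕₚ.*-monoʳ-≤ b (nP′k≤n^k n r))) ⟩
  q ℕ.* (a ℕ.* (r ! ℕ.* e) ℕ.+ b ℕ.* n ^ r)              ≤⟨ ℕₚ.*-monoʳ-≤ q (edge-boundℕ H t 2≤t big free) ⟩
  q ℕ.* (a ℕ.* n ^ r)                                  ≡⟨ j q a (n ^ r) ⟩
  a ℕ.* (q ℕ.* n ^ r)                                  ≤⟨ ℕₚ.*-monoʳ-≤ a (power≤falling q r≤n (ℕₚ.<-≤-trans (s≤s z≤n) r≤n) big') ⟩
  a ℕ.* (suc q ℕ.* (n P′ r))                           ≡⟨ cong (λ p → a ℕ.* (suc q ℕ.* p)) (nCk*k!≡nP′k r≤n) ⟨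
  a ℕ.* (suc q ℕ.* (c ℕ.* r !))                        ≡⟨ l (r !) q a c ⟩
  r ! ℕ.* (suc q ℕ.* a ℕ.* c)                          ∎)
  where
  open ℕₚ.≤-Reasoning
  r = 3 ℕ.+ k
  e = e[ H ]
  a = 12 ℕ.* (t ℕ.* t)
  b = 12 ℕ.* t ℕ.+ 1
  c = n C r
  i : ∀ f q a e b c → f ℕ.* (q ℕ.* a ℕ.* e ℕ.+ q ℕ.* b ℕ.* c) ≡ q ℕ.* (a ℕ.* (f ℕ.* e) ℕ.+ b ℕ.* (c ℕ.* f))
  i = solve-∀ℕ
  j : ∀ q a m → q ℕ.* (a ℕ.* m) ≡ a ℕ.* (q ℕ.* m)
  j = solve-∀ℕ
  l : ∀ f q a c → a ℕ.* ((1 ℕ.+ q) ℕ.* (c ℕ.* f)) ≡ f ℕ.* ((1 ℕ.+ q) ℕ.* a ℕ.* c)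
  l = solve-∀ℕ

-- Unnormalised fractions keep their denominators, so that the cross-multiplied inequality is
-- reached by conversion; `mkℚᵘ` takes the denominator minus one, hence `pred`.
boundᵘ : ℕ → ℚᵘ
boundᵘ t' = mkℚᵘ 1ℤ 0 ℚᵘ.- mkℚᵘ 1ℤ t' ℚᵘ.- mkℚᵘ 1ℤ (ℕ.pred (12 ℕ.* (suc t' ℕ.* suc t')))

toℚᵘ-homo-- : ∀ p q → toℚᵘ (p ℚ.- q) ≃ toℚᵘ p ℚᵘ.- toℚᵘ q
toℚᵘ-homo-- p q = ℚᵘₚ.≃-trans (ℚₚ.toℚᵘ-homo-+ p (ℚ.- q)) (ℚᵘₚ.+-congʳ (toℚᵘ p) (ℚₚ.toℚᵘ-homo‿- q))

toℚᵘ-bound : ∀ t' → toℚᵘ (bound (suc t')) ≃ boundᵘ t'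
toℚᵘ-bound t' = ℚᵘₚ.≃-trans (toℚᵘ-homo-- (1ℚ ℚ.- recipℕ (suc t')) (recipℕ (12 ℕ.* (suc t' ℕ.* suc t'))))
  (ℚᵘₚ.+-cong (ℚᵘₚ.≃-trans (toℚᵘ-homo-- 1ℚ (recipℕ (suc t'))) (ℚᵘₚ.+-congʳ (toℚᵘ 1ℚ) (ℚᵘₚ.-‿cong (ℚₚ.toℚᵘ-fromℚᵘ (mkℚᵘ 1ℤ t')))))
    (ℚᵘₚ.-‿cong (ℚₚ.toℚᵘ-fromℚᵘ (mkℚᵘ 1ℤ (ℕ.pred (12 ℕ.* (suc t' ℕ.* suc t')))))))

module Rational (t' p d e c : ℕ)
  (h : suc d ℕ.* (12 ℕ.* (suc t' ℕ.* suc t')) ℕ.* e ℕ.+ suc d ℕ.* (12 ℕ.* suc t' ℕ.+ 1) ℕ.* c ℕ.≤ suc (suc d) ℕ.* (12 ℕ.* (suc t' ℕ.* suc t')) ℕ.* c) where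

  T q a b : ℤ
  T = + suc t'
  q = + suc d
  a = + (12 ℕ.* (suc t' ℕ.* suc t'))
  b = + (12 ℕ.* suc t' ℕ.+ 1)

  hℤ : q ℤ.* a ℤ.* + e ℤ.+ q ℤ.* b ℤ.* + c ≤ (1ℤ ℤ.+ q) ℤ.* a ℤ.* + c
  hℤ = subst₂ _≤_ (trans (ℤₚ.pos-+ (suc d ℕ.* (12 ℕ.* (suc t' ℕ.* suc t')) ℕ.* e) _) (cong₂ ℤ._+_ (triple (suc d) (12 ℕ.* (suc t' ℕ.* suc t')) e) (triple (suc d) (12 ℕ.* suc t' ℕ.+ 1) c)))
    (triple (suc (suc d)) (12 ℕ.* (suc t' ℕ.* suc t')) c) (+≤+ h)
    where
    triple : ∀ x y z → + (x ℕ.* y ℕ.* z) ≡ + x ℤ.* + y ℤ.* + z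
    triple x y z = trans (ℤₚ.pos-* (x ℕ.* y) z) (cong (ℤ._* + z) (ℤₚ.pos-* x y))

  -- The left-hand side is, up to conversion, the cross-multiplied form of `inequality`.
  identity : ∀ T q p e c →
    (((1ℤ ℤ.* T ℤ.+ ℤ.- 1ℤ ℤ.* 1ℤ) ℤ.* (+ 12 ℤ.* (T ℤ.* T)) ℤ.+ ℤ.- 1ℤ ℤ.* (1ℤ ℤ.* T)) ℤ.* q
      ℤ.+ (1ℤ ℤ.+ p) ℤ.* (1ℤ ℤ.* T ℤ.* (+ 12 ℤ.* (T ℤ.* T)))) ℤ.* c ℤ.* 1ℤ
      ℤ.- e ℤ.* (1ℤ ℤ.* T ℤ.* (+ 12 ℤ.* (T ℤ.* T)) ℤ.* q ℤ.* 1ℤ) ≡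
    T ℤ.* ((1ℤ ℤ.+ q) ℤ.* (+ 12 ℤ.* (T ℤ.* T)) ℤ.* c ℤ.- (q ℤ.* (+ 12 ℤ.* (T ℤ.* T)) ℤ.* e ℤ.+ q ℤ.* (+ 12 ℤ.* T ℤ.+ 1ℤ) ℤ.* c))
      ℤ.+ p ℤ.* (T ℤ.* (+ 12 ℤ.* (T ℤ.* T)) ℤ.* c)
  identity = solve-∀

  opaque
    unfolding _+_
    -- With ε = (1 + p)/(1 + d), the part 1/(1 + d) is paid for by `hℤ`; the rest p/(1 + d) accounts
    -- for the second summand.
    nonneg : 0ℤ ≤ T ℤ.* ((1ℤ ℤ.+ q) ℤ.* a ℤ.* + c ℤ.- (q ℤ.* a ℤ.* + e ℤ.+ q ℤ.* b ℤ.* + c)) ℤ.+ + p ℤ.* (T ℤ.* a ℤ.* + c)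
    nonneg = 0≤+ (0≤* {T} 0≤+n (gap hℤ)) (0≤* {+ p} 0≤+n (0≤* {T ℤ.* a} (0≤* {T} {a} 0≤+n 0≤+n) 0≤+n))

  inequality : mkℚᵘ (+ e) 0 ℚᵘ.≤ (boundᵘ t' ℚᵘ.+ mkℚᵘ +[1+ p ] d) ℚᵘ.* mkℚᵘ (+ c) 0
  inequality = ℚᵘ.*≤* (ℤₚ.0≤i-j⇒j≤i (subst (0ℤ ≤_) (sym (identity T q (+ p) (+ e) (+ c))) nonneg))

  result : ∀ .(cop : Coprime (suc p) (suc d)) → toℚ e ℚ.≤ (bound (suc t') ℚ.+ mkℚ +[1+ p ] d cop) ℚ.* toℚ c
  result cop = ℚₚ.toℚᵘ-cancel-≤ (ℚᵘₚ.≤-respˡ-≃ (ℚᵘₚ.≃-sym (ℚₚ.toℚᵘ-fromℚᵘ (mkℚᵘ (+ e) 0))) (ℚᵘₚ.≤-respʳ-≃ (ℚᵘₚ.≃-sym rhs) inequality))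
    where
    ε : ℚ
    ε = mkℚ +[1+ p ] d cop
    rhs : toℚᵘ ((bound (suc t') ℚ.+ ε) ℚ.* toℚ c) ≃ (boundᵘ t' ℚᵘ.+ mkℚᵘ +[1+ p ] d) ℚᵘ.* mkℚᵘ (+ c) 0
    rhs = ℚᵘₚ.≃-trans (ℚₚ.toℚᵘ-homo-* (bound (suc t') ℚ.+ ε) (toℚ c)) (ℚᵘₚ.*-cong
      (ℚᵘₚ.≃-trans (ℚₚ.toℚᵘ-homo-+ (bound (suc t')) ε) (ℚᵘₚ.+-congˡ (toℚᵘ ε) (toℚᵘ-bound t')))
      (ℚₚ.toℚᵘ-fromℚᵘ (mkℚᵘ (+ c) 0)))

theorem1p3 : (r t : ℕ) → 3 ℕ.≤ r → 2 ℕ.≤ t → TuranDensityDaisy≤ r t (bound t)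
theorem1p3 (suc (suc (suc k))) (suc t') (s≤s (s≤s (s≤s z≤n))) 2≤t (mkℚ +[1+ p ] d cop) _ =
    N₁ ℕ.+ (N₂ ℕ.+ N₃) , λ n N≤n H free → Rational.result t' p d e[ H ] (n C r)
      (edge-bound-C H t (suc d) 2≤t (ℕₚ.≤-trans (ℕₚ.m≤m+n N₁ _) N≤n)
        (ℕₚ.≤-trans (ℕₚ.≤-trans (ℕₚ.m≤m+n N₂ N₃) (ℕₚ.m≤n+m _ N₁)) N≤n)
        (ℕₚ.≤-trans (ℕₚ.≤-trans (ℕₚ.m≤n+m N₃ N₂) (ℕₚ.m≤n+m _ N₁)) N≤n) free) cop
  where
  r t N₁ N₂ N₃ : ℕ
  r = 3 ℕ.+ k
  t = suc t'
  -- 15t leaves room for the truncation level; r² (q + 1) with q = suc d serves the passage to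
  -- binomials, where 1/q ≤ ε.
  N₁ = 15 ℕ.* t
  N₂ = r
  N₃ = r ℕ.* r ℕ.* suc (suc d)
theorem1p3 (suc zero) _ (s≤s ())
theorem1p3 (suc (suc zero)) _ (s≤s (s≤s ()))
theorem1p3 r t _ _ (mkℚ (+ 0) _ _) (ℚ.*<* (ℤ.+<+ ()))
theorem1p3 r t _ _ (mkℚ -[1+ _ ] _ _) (ℚ.*<* ())
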